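{- Let $0\le\varepsilon<1$. There exists an efficient (polynomial-time) adaptive algorithm which detects the target $t$ in any graph with $n$ vertices in at most $\frac{\log n}{1-\log(1+\varepsilon)}$ direction queries, by querying at each iteration an arbitrary $(1+\varepsilon)$-median of its current candidates' set for the potential function $\Gamma$.
   Context: All logarithms are base $2$. Graphs $G=(V,E)$, $|V|=n$, are connected, simple, undirected, with positive edge weights $w:E\to\mathbb{R}^+$; $d$ is the shortest-path distance, and $N(v)$ is the set of neighbors of $v$. For $u\in N(v)$, $N(v,u)=\{x\in V: d(v,x)=w(vu)+d(u,x)\}$ is the set of vertices $x$ for which some shortest path from $v$ to $x$ starts with the edge $vu$. There is one unknown target $t\in V$. A direction query at $v$ reveals that $v=t$ if this is the case, and otherwise returns a (possibly adversarially chosen) neighbor $u\in N(v)$ with $t\in N(v,u)$. For $S\subseteq V$ and $v\in V$, the potential is $\Gamma_S(v)=\max\{|N(v,u)\cap S|: u\in N(v)\}$. A vertex $x\in V$ is a $(1+\varepsilon)$-median of $S$ for $\Gamma$ if $\Gamma_S(x)\le(1+\varepsilon)\min_{v\in V}\Gamma_S(v)$. The candidates' set $S\subseteq V$ is a set maintained by the algorithm such that always $t\in S$; initially $S=V$, and after a query at $v$ with response $u\in N(v)$ it is replaced by $S\cap N(v,u)$. The target is detected when it is revealed by a query or when $|S|=1$. -}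

module Defs where

open import Level using (Level; _⊔_; 0ℓ) renaming (suc to lsuc)
open import Algebra.Bundles using (CommutativeRing)
import Algebra.Definitions.RawMonoid as RawMonoidDefinitions
open import Data.Bool using (Bool; true; false; if_then_else_; _∧_)
open import Data.Fin using (Fin; toℕ; fromℕ<)
import Data.Fin.Properties as Fin
open import Data.Fin.Subset using (Subset; _∈_; _∩_; ∣_∣; ⊤)
open import Data.List using (List; []; _∷_; _++_; length; map; filter; concatMap; allFin; lookup)
import Data.List.Extrema as Extrema
open import Data.List.Extrema.Nat using (max; min)
open import Data.List.Membership.Propositional using () renaming (_∈_ to _∈ˡ_)
open import Data.List.Membership.Propositional.Properties
  using (∈-++⁺ˡ; ∈-++⁺ʳ; ∈-concatMap⁺; ∈-map⁺; ∈-allFin; ∈-lookup)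
import Data.List.Membership.DecPropositional as DecMembership
open import Data.List.Relation.Unary.All as All using (All; []; _∷_)
open import Data.List.Relation.Unary.All.Properties using (¬Any⇒All¬)
open import Data.List.Relation.Unary.AllPairs using ([]; _∷_)
open import Data.List.Relation.Unary.Any as Any using (Any; here; there)
open import Data.List.Relation.Unary.Unique.Propositional using (Unique)
open import Data.Nat as ℕ using (ℕ; zero; suc; _≡ᵇ_; _≤ᵇ_)
import Data.Nat.Properties as ℕ
open import Data.Product using (Σ; ∃; _×_; _,_; proj₁; proj₂)
open import Data.Sum using (_⊎_)
open import Data.Vec using (tabulate)
open import Relation.Binary using (Rel; Decidable; IsDecTotalOrder; TotalOrder)
open import Relation.Binary.Construct.Closure.ReflexiveTransitive
  using (Star; _◅_) renaming (ε to [·])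
open import Relation.Binary.PropositionalEquality as ≡ using (_≡_; _≢_)
open import Relation.Nullary using (¬_; yes; no; contradiction)
open import Relation.Nullary.Decidable using (⌊_⌋)

------------------------------------------------------------------------
-- Real numbers

-- An ordered field with a base-2 logarithm.  The intended instance is the
-- (classical) field ℝ, where the laws below determine the logarithm.
-- As usual for totalised operations, 0# ⁻¹ and the logarithm of a
-- nonpositive element are unconstrained.

record RealField (c ℓ₁ ℓ₂ : Level) : Set (lsuc (c ⊔ ℓ₁ ⊔ ℓ₂)) where
  infix  4 _≤_ _<_
  infix  8 _⁻¹
  infixl 7 _/_

  field
    commutativeRing : CommutativeRing c ℓ₁
  open CommutativeRing commutativeRing public

  field
    _≤_             : Rel Carrier ℓ₂
    isDecTotalOrder : IsDecTotalOrder _≈_ _≤_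
    0≉1             : ¬ (0# ≈ 1#)
    +-monoˡ-≤       : ∀ z {x y} → x ≤ y → x + z ≤ y + z
    *-nonneg        : ∀ {x y} → 0# ≤ x → 0# ≤ y → 0# ≤ x * y
    _⁻¹             : Carrier → Carrier
    ⁻¹-cong         : ∀ {x y} → x ≈ y → x ⁻¹ ≈ y ⁻¹
    *-inverseʳ      : ∀ {x} → ¬ (x ≈ 0#) → x * x ⁻¹ ≈ 1#

  _<_ : Rel Carrier (ℓ₁ ⊔ ℓ₂)
  x < y = x ≤ y × ¬ (x ≈ y)

  _/_ : Carrier → Carrier → Carrier
  x / y = x * y ⁻¹

  field
    log      : Carrier → Carrier
    log-cong : ∀ {x y} → x ≈ y → log x ≈ log y
    log-*    : ∀ {x y} → 0# < x → 0# < y → log (x * y) ≈ log x + log y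
    log-<    : ∀ {x y} → 0# < x → x < y → log x < log y
    log-2    : log (1# + 1#) ≈ 1#

  open IsDecTotalOrder isDecTotalOrder public
    using (_≟_; _≤?_; total; antisym; ≤-respˡ-≈; ≤-respʳ-≈)
    renaming (refl to ≤-refl; reflexive to ≤-reflexive; trans to ≤-trans)

  totalOrder : TotalOrder c ℓ₁ ℓ₂
  totalOrder = record { isTotalOrder = IsDecTotalOrder.isTotalOrder isDecTotalOrder }

  fromℕ : ℕ → Carrier
  fromℕ k = k · 1#
    where open RawMonoidDefinitions +-rawMonoid renaming (_×_ to _·_)

module DirectionSearch {c ℓ₁ ℓ₂} (R : RealField c ℓ₁ ℓ₂) where
  open RealField R

  ----------------------------------------------------------------------
  -- Weighted graphs

  -- Connected simple graphs on the vertex set Fin n.  Only the weights of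
  -- edges are meaningful.

  record Graph (n : ℕ) : Set (lsuc 0ℓ ⊔ c ⊔ ℓ₁ ⊔ ℓ₂) where
    field
      Adj        : Rel (Fin n) 0ℓ
      adj?       : Decidable Adj
      adj-sym    : ∀ {u v} → Adj u v → Adj v u
      adj-irrefl : ∀ {v} → ¬ Adj v v
      connected  : ∀ u v → Star Adj u v
      weight     : Fin n → Fin n → Carrier
      weight-sym : ∀ {u v} → Adj u v → weight u v ≈ weight v u
      weight-pos : ∀ {u v} → Adj u v → 0# < weight u v

    Walk : Fin n → Fin n → Set
    Walk = Star Adj

    len : ∀ {u v} → Walk u v → Carrier
    len [·]                     = 0#
    len (_◅_ {i = u} {j = v} _ p) = weight u v + len p

    private
      open DecMembership (Fin._≟_ {n}) using (_∈?_)

      vertices : ∀ {u v} → Walk u v → List (Fin n)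
      vertices {u} [·]     = u ∷ []
      vertices {u} (_ ◅ p) = u ∷ vertices p

      Simple : ∀ {u v} → Walk u v → Set
      Simple p = Unique (vertices p)

      size : ∀ {u v} → Walk u v → ℕ
      size [·]     = 0
      size (_ ◅ p) = suc (size p)

      +-monoʳ : ∀ z {x y} → x ≤ y → z + x ≤ z + y
      +-monoʳ z {x} {y} x≤y =
        ≤-respˡ-≈ (+-comm x z) (≤-respʳ-≈ (+-comm y z) (+-monoˡ-≤ z x≤y))

      ≤-+ˡ : ∀ {w} x → 0# ≤ w → x ≤ w + x
      ≤-+ˡ x 0≤w = ≤-respˡ-≈ (+-identityˡ x) (+-monoˡ-≤ x 0≤w)

      suffix : ∀ {u v x} (p : Walk u v) → Simple p → x ∈ˡ vertices p →
               Σ (Walk x v) λ q → Simple q × len q ≤ len p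
      suffix [·]     s       (here ≡.refl) = [·] , s , ≤-refl
      suffix (e ◅ p) s       (here ≡.refl) = e ◅ p , s , ≤-refl
      suffix (e ◅ p) (_ ∷ s) (there x∈p)   with suffix p s x∈p
      ... | q , sq , q≤p = q , sq , ≤-trans q≤p (≤-+ˡ _ (proj₁ (weight-pos e)))

      simplify : ∀ {u v} (p : Walk u v) → Σ (Walk u v) λ q → Simple q × len q ≤ len p
      simplify [·]         = [·] , [] ∷ [] , ≤-refl
      simplify {u} (_◅_ {j = w} e p) with simplify p
      ... | q , sq , q≤p with u ∈? vertices q
      ... | no  u∉q = e ◅ q , ¬Any⇒All¬ _ u∉q ∷ sq , +-monoʳ (weight u w) q≤p
      ... | yes u∈q with suffix q sq u∈q
      ... | r , sr , r≤q =
        r , sr , ≤-trans r≤q (≤-trans q≤p (≤-+ˡ _ (proj₁ (weight-pos e))))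

      lookup-injective : ∀ {xs : List (Fin n)} → Unique xs →
                         ∀ {i j} → lookup xs i ≡ lookup xs j → i ≡ j
      lookup-injective (_ ∷ _)  {Fin.zero}  {Fin.zero}  _  = ≡.refl
      lookup-injective {_ ∷ xs} (x∉ ∷ _) {Fin.zero} {Fin.suc j} eq =
        contradiction eq (All.lookup x∉ (∈-lookup {xs = xs} j))
      lookup-injective {_ ∷ xs} (x∉ ∷ _) {Fin.suc i} {Fin.zero} eq =
        contradiction (≡.sym eq) (All.lookup x∉ (∈-lookup {xs = xs} i))
      lookup-injective (_ ∷ s)  {Fin.suc i} {Fin.suc j} eq =
        ≡.cong Fin.suc (lookup-injective s eq)

      size<vertices : ∀ {u v} (p : Walk u v) → size p ℕ.≤ length (vertices p)
      size<vertices [·]     = ℕ.z≤n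
      size<vertices (_ ◅ p) = ℕ.s≤s (size<vertices p)

      simple-size : ∀ {u v} (p : Walk u v) → Simple p → size p ℕ.≤ n
      simple-size p s =
        ℕ.≤-trans (size<vertices p) (Fin.injective⇒≤ (lookup-injective s))

      trivial : ∀ u v → List (Walk u v)
      trivial u v with u Fin.≟ v
      ... | yes ≡.refl = [·] ∷ []
      ... | no  _      = []

      walks : ℕ → ∀ u v → List (Walk u v)
      via   : ℕ → ∀ u v → Fin n → List (Walk u v)

      walks zero    u v = trivial u v
      walks (suc k) u v = trivial u v ++ concatMap (via k u v) (allFin n)

      via k u v w with adj? u w
      ... | yes e = map (e ◅_) (walks k w v)
      ... | no  _ = []

      -- Up to the choice of adjacency proofs, which does not affect length,
      -- walks k u v lists all walks with at most k edges.

      Listed : ∀ {u v} → Walk u v → List (Walk u v) → Set c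
      Listed p ps = ∃ λ q → q ∈ˡ ps × len q ≡ len p

      trivial-complete : ∀ u → [·] ∈ˡ trivial u u
      trivial-complete u with u Fin.≟ u
      ... | yes ≡.refl = here ≡.refl
      ... | no  u≢u    = contradiction ≡.refl u≢u

      walks-complete : ∀ k {u v} (p : Walk u v) → size p ℕ.≤ k → Listed p (walks k u v)
      via-complete   : ∀ k {u v w} (e : Adj u w) (p : Walk w v) → size p ℕ.≤ k →
                       Listed (e ◅ p) (via k u v w)

      walks-complete zero    [·] _ = [·] , trivial-complete _ , ≡.refl
      walks-complete (suc k) [·] _ = [·] , ∈-++⁺ˡ (trivial-complete _) , ≡.refl
      walks-complete (suc k) {u} {v} (_◅_ {j = w} e p) (ℕ.s≤s p≤k)
        with via-complete k e p p≤k
      ... | q , q∈ , eq =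
        q , ∈-++⁺ʳ (trivial u v)
              (∈-concatMap⁺ (via k u v) (Any.map (λ { ≡.refl → q∈ }) (∈-allFin w)))
          , eq

      via-complete k {u} {v} {w} e p p≤k with adj? u w
      ... | no ¬e = contradiction e ¬e
      ... | yes e′ with walks-complete k p p≤k
      ... | q , q∈ , eq = e′ ◅ q , ∈-map⁺ (e′ ◅_) q∈ , ≡.cong (weight u w +_) eq

    abstract
      shortest : ∀ u v → Σ (Walk u v) λ p → ∀ (q : Walk u v) → len p ≤ len q
      shortest u v = argmin len p₀ ps , minimal
        where
        open Extrema totalOrder using (argmin; f[argmin]≤f[xs])

        p₀ : Walk u v
        p₀ = connected u v

        ps : List (Walk u v)
        ps = walks n u v

        minimal : ∀ (q : Walk u v) → len (argmin len p₀ ps) ≤ len q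
        minimal q with simplify q
        ... | r , sr , r≤q with walks-complete n r (simple-size r sr)
        ... | r′ , r′∈ , eq =
          ≤-trans (All.lookup (f[argmin]≤f[xs] {f = len} p₀ ps) r′∈)
                  (≤-trans (≤-reflexive (reflexive eq)) r≤q)

    d : Fin n → Fin n → Carrier
    d u v = len (proj₁ (shortest u v))

    N : Fin n → Fin n → Subset n
    N v u = tabulate λ x → ⌊ d v x ≟ weight v u + d u x ⌋

    neighbours : Fin n → List (Fin n)
    neighbours v = filter (adj? v) (allFin n)

    Γ : Subset n → Fin n → ℕ
    Γ S v = max 0 (map (λ u → ∣ N v u ∩ S ∣) (neighbours v))

    -- The minimum of Γ S over all vertices is written as a minimum seeded
    -- with the value at x, which is itself one of the values compared.

    IsMedian : Carrier → Subset n → Fin n → Set ℓ₂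
    IsMedian ε S x =
      fromℕ (Γ S x) ≤ (1# + ε) * fromℕ (min (Γ S x) (map (Γ S) (allFin n)))

  ----------------------------------------------------------------------
  -- Queries

  data Response (n : ℕ) : Set where
    found  : Response n
    toward : Fin n → Response n

  data IsFound {n} : Fin n × Response n → Set where
    found : ∀ {v} → IsFound (v , found)

  -- The queries made so far with their responses, latest first.
  History : ℕ → Set
  History n = List (Fin n × Response n)

  -- Responses may depend on everything that happened before.
  Responder : ℕ → Set
  Responder n = History n → Fin n → Response n

  Strategy : ℕ → Set
  Strategy n = History n → Fin n

  play : ∀ {n} → Strategy n → Responder n → ℕ → History n
  play σ O zero    = []
  play σ O (suc k) = let h = play σ O k in (σ h , O h (σ h)) ∷ h

  module _ {n} (G : Graph n) where
    open Graph G

    data Correct (t v : Fin n) : Response n → Set where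
      found  : v ≡ t → Correct t v found
      toward : ∀ {u} → v ≢ t → Adj v u → t ∈ N v u → Correct t v (toward u)

    Truthful : Fin n → Responder n → Set
    Truthful t O = ∀ h v → Correct t v (O h v)

    candidates : History n → Subset n
    candidates []                   = ⊤
    candidates ((v , found)    ∷ h) = candidates h
    candidates ((v , toward u) ∷ h) = candidates h ∩ N v u

    Detected : History n → Set
    Detected h = Any IsFound h ⊎ ∣ candidates h ∣ ≡ 1

    -- A strategy that, in its play against O, queries some (1+ε)-median of
    -- the current candidates' set as long as the target is undetected.
    QueriesMedians : Carrier → Responder n → Strategy n → Set ℓ₂
    QueriesMedians ε O σ = ∀ k → let h = play σ O k in
      ¬ Detected h → IsMedian ε (candidates h) (σ h)

    -- Histories all of whose queries were made before detection and at a
    -- (1+ε)-median of the candidates' set of that moment.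
    data MedianHistory (ε : Carrier) : History n → Set ℓ₂ where
      []    : MedianHistory ε []
      query : ∀ {v r h} → ¬ Detected h → IsMedian ε (candidates h) v →
              MedianHistory ε h → MedianHistory ε ((v , r) ∷ h)

  queryBound : ℕ → Carrier → Carrier
  queryBound n ε = log (fromℕ n) / (1# - log (1# + ε))

  ----------------------------------------------------------------------
  -- Programs

  -- A random access machine with two-dimensional arrays of naturals and of
  -- weights, which can query vertices.  Numbers can only be added and
  -- compared: a program making T steps on weights of B bits handles numbers
  -- of O(B + T) bits, so unit cost per step is a sound measure of polynomial
  -- time.

  Array : Set
  Array = ℕ

  infix 9 _[_,_]
  infixl 8 _⊕_
  infix 7 _≤ⁿ_ _≤ʷ_
  infix 6 _[_,_]≔ⁿ_ _[_,_]≔ʷ_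
  infixr 5 _⨾_

  data NatExp : Set where
    lit     : ℕ → NatExp
    _[_,_]  : Array → NatExp → NatExp → NatExp
    _⊕_     : NatExp → NatExp → NatExp

  data WeightExp : Set where
    zeroʷ   : WeightExp
    _[_,_]  : Array → NatExp → NatExp → WeightExp
    _⊕_     : WeightExp → WeightExp → WeightExp

  data Test : Set where
    _≤ⁿ_ : NatExp → NatExp → Test
    _≤ʷ_ : WeightExp → WeightExp → Test

  data Program : Set where
    skip          : Program
    _[_,_]≔ⁿ_     : Array → NatExp → NatExp → NatExp → Program
    _[_,_]≔ʷ_     : Array → NatExp → NatExp → WeightExp → Program
    _⨾_           : Program → Program → Program
    cond          : Test → Program → Program → Program
    -- The counter is the cell [ 0 , 0 ] of the given array; the number of
    -- iterations is evaluated once, on entry.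
    loop          : Array → NatExp → Program → Program
    -- Queries the vertex with the given number and stores the response in
    -- the cell [ 0 , 0 ] of the given array: 0 for found, and 1 + toℕ u for
    -- toward u.  No query is made if the number is not that of a vertex.
    query         : NatExp → Array → Program

  Memory : ∀ {a} → Set a → Set a
  Memory A = Array → ℕ → ℕ → A

  store : ∀ {a} {A : Set a} → Array → ℕ → ℕ → A → Memory A → Memory A
  store a i j x m a′ i′ j′ =
    if (a ≡ᵇ a′) ∧ (i ≡ᵇ i′) ∧ (j ≡ᵇ j′) then x else m a′ i′ j′

  record Config (n : ℕ) : Set c where
    field
      nats    : Memory ℕ
      weights : Memory Carrier
      history : History n
      time    : ℕ

  open Config public

  module _ {n} (O : Responder n) where

    evalⁿ : NatExp → Config n → ℕ
    evalⁿ (lit k)       s = k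
    evalⁿ (a [ e , f ]) s = nats s a (evalⁿ e s) (evalⁿ f s)
    evalⁿ (e ⊕ f)       s = evalⁿ e s ℕ.+ evalⁿ f s

    evalʷ : WeightExp → Config n → Carrier
    evalʷ zeroʷ         s = 0#
    evalʷ (a [ e , f ]) s = weights s a (evalⁿ e s) (evalⁿ f s)
    evalʷ (e ⊕ f)       s = evalʷ e s + evalʷ f s

    test : Test → Config n → Bool
    test (e ≤ⁿ f) s = evalⁿ e s ≤ᵇ evalⁿ f s
    test (e ≤ʷ f) s = ⌊ evalʷ e s ≤? evalʷ f s ⌋

    tick : Config n → Config n
    tick s = record s { time = suc (time s) }

    storeⁿ : Array → ℕ → ℕ → ℕ → Config n → Config n
    storeⁿ a i j k s = record s { nats = store a i j k (nats s) }

    storeʷ : Array → ℕ → ℕ → Carrier → Config n → Config n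
    storeʷ a i j x s = record s { weights = store a i j x (weights s) }

    code : Response n → ℕ
    code found      = 0
    code (toward u) = suc (toℕ u)

    ask : Array → Fin n → Config n → Config n
    ask a v s = let r = O (history s) v in
      storeⁿ a 0 0 (code r) (record s { history = (v , r) ∷ history s })

    iterate : (ℕ → Config n → Config n) → ℕ → Config n → Config n
    iterate f zero    s = s
    iterate f (suc k) s = f k (iterate f k s)

    exec : Program → Config n → Config n
    exec skip                   s = tick s
    exec (a [ e , f ]≔ⁿ g)      s = tick (storeⁿ a (evalⁿ e s) (evalⁿ f s) (evalⁿ g s) s)
    exec (a [ e , f ]≔ʷ g)      s = tick (storeʷ a (evalⁿ e s) (evalⁿ f s) (evalʷ g s) s)
    exec (p ⨾ q)                s = exec q (exec p s)
    exec (cond b p q)           s = if test b s then exec p (tick s) else exec q (tick s)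
    exec (loop a e p)           s =
      iterate (λ i s′ → exec p (tick (storeⁿ a 0 0 i s′))) (evalⁿ e s) (tick s)
    exec (query e a)            s with evalⁿ e s ℕ.<? n
    ... | yes e<n = ask a (fromℕ< e<n) (tick s)
    ... | no  _   = tick s

  module _ {n} (G : Graph n) where
    open Graph G

    atVertices : ∀ {a} {A : Set a} → (Fin n → Fin n → A) → A → ℕ → ℕ → A
    atVertices f z i j with i ℕ.<? n | j ℕ.<? n
    ... | yes i<n | yes j<n = f (fromℕ< i<n) (fromℕ< j<n)
    ... | _       | _       = z

    -- The cell [ 0 , 0 ] of array 0 of naturals holds the number of vertices,
    -- array 1 of naturals the adjacency matrix, and array 0 of weights the
    -- weight matrix.  All other cells hold zero.

    inputNats : Memory ℕ
    inputNats 0 0 0 = n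
    inputNats 1 i j = atVertices (λ u v → if ⌊ adj? u v ⌋ then 1 else 0) 0 i j
    inputNats _ _ _ = 0

    inputWeights : Memory Carrier
    inputWeights 0 i j =
      atVertices (λ u v → if ⌊ adj? u v ⌋ then weight u v else 0#) 0# i j
    inputWeights _ _ _ = 0#

    input : Config n
    input = record
      { nats    = inputNats
      ; weights = inputWeights
      ; history = []
      ; time    = 0
      }

    run : Program → Responder n → Config n
    run p O = exec O p input

  -- The result of a program is left in the cell [ 0 , 0 ] of array 2.
  output : ∀ {n} → Config n → ℕ
  output s = nats s 2 0 0

module Submission where

-- Every candidates' set S has a vertex v with 2 Γ_S(v) ≤ |S|, namely any v
-- minimising the sum Φ(v) of the distances to the elements of S: moving from
-- v to a neighbour u over an edge of weight w changes each distance by at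
-- most w and shortens it by exactly w on N(v,u), so if N(v,u) held more than
-- half of S, then Φ(u) would be smaller than Φ(v) (half-median).  Hence, with
-- ρ = 1 + ε, the answer to a query at a (1+ε)-median replaces S by a set S'
-- with 2|S'| ≤ ρ|S|, unless it reveals the target (shrink).  Taking logarithms, with δ = 1 - log ρ > 0,
--
--   k δ + log |S| ≤ log n
--
-- after k queries that have not revealed the target (potential).  Before the
-- last query |S| ≥ 2, and log 2 = 1 ≥ δ pays for that query, so that k δ ≤
-- log n also when the last answer reveals the target (paid).  As |S| strictly
-- decreases, detection does happen (detects).
--
-- The algorithm computes all distances, then repeats n times: count the
-- candidates, and if there are at least two, compute Γ_S at every vertex,
-- query a minimiser (an exact median does for every ε) and restrict the
-- candidates to the answer.  When the target is found it is left as the only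
-- candidate, which stops the queries.
--
-- Distances come from the algorithm of Floyd and Warshall, with a table of
-- flags instead of infinite weights.  The table is read as the relation
-- "there is an entry at (u,v), of value at most x", and the invariant is the
-- triangle inequality through the first k vertices (Triangle), which makes no
-- mention of intermediate vertices of walks.  Once it holds for all vertices,
-- induction on walks bounds every entry by the length of every walk.
--
-- Programs are verified piece by piece: frame says that a program changes
-- only the arrays that occur as its targets, and for-rule is the invariant
-- rule for loops with n iterations.  If all loops have n iterations, then the
-- running time is polynomial by a computation on the syntax (time-≤ and
-- steps-≤).

open import Defs
open import Data.Fin using (Fin; toℕ)
open import Data.List using (length)
open import Data.Nat using (ℕ; _^_)
open import Data.Product using (∃; ∃₂; _×_)
open import Relation.Binary.PropositionalEquality using (_≡_)
import Data.Nat as ℕ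

open import Level using (_⊔_)
open import Data.Bool using (Bool; true; false; T; if_then_else_; _∧_; _∨_)
import Data.Bool.Properties as Bool
open import Data.Fin using (fromℕ<)
import Data.Fin.Properties as Fin
open import Data.Fin.Subset using (Subset; _∈_; _∩_; ∣_∣; ⊤; ⁅_⁆)
import Data.Fin.Subset.Properties as Subset
open import Data.List using (List; []; _∷_; allFin; map)
import Data.List.Extrema as Extrema
import Data.List.Extrema.Nat as Extremaℕ
open import Data.List.Membership.Propositional.Properties using (∈-allFin; ∈-filter⁺; ∈-map⁺)
open import Data.List.Relation.Unary.All as All using (All; []; _∷_)
import Data.List.Relation.Unary.All.Properties as All
open import Data.List.Relation.Unary.Any as Any using (Any; here; there)
open import Data.Nat using (zero; suc; _≡ᵇ_; _≤ᵇ_)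
import Data.Nat.Properties as ℕ
open import Data.Nat.Tactic.RingSolver using (solve-∀)
open import Data.Product using (_,_; proj₁; proj₂)
open import Data.Sum using (_⊎_; inj₁; inj₂; [_,_]′)
open import Data.Unit using (tt) renaming (⊤ to Unit)
open import Data.Vec using ([]; _∷_; lookup)
import Data.Vec.Properties as Vec
open import Function using (_∘_)
open import Relation.Binary.Construct.Closure.ReflexiveTransitive using (_◅_; _◅◅_) renaming (ε to [·])
open import Relation.Binary.PropositionalEquality as ≡ using (_≢_; refl)
open import Relation.Nullary using (¬_; Dec; yes; no; contradiction)
open import Relation.Nullary.Decidable using (⌊_⌋; toWitness; _⊎-dec_)

-- Ordered fields and logarithms

module OrderedField {c ℓ₁ ℓ₂} (R : RealField c ℓ₁ ℓ₂) where
  open RealField R renaming (refl to ≈-refl; sym to ≈-sym; trans to ≈-trans)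
  open import Algebra.Properties.Ring ring using (-‿distribˡ-*; -‿involutive)
  open import Algebra.Properties.Monoid.Mult +-monoid using (×-homo-+)

  +-monoʳ-≤ : ∀ z {x y} → x ≤ y → z + x ≤ z + y
  +-monoʳ-≤ z {x} {y} x≤y =
    ≤-respˡ-≈ (+-comm x z) (≤-respʳ-≈ (+-comm y z) (+-monoˡ-≤ z x≤y))

  +-mono-≤ : ∀ {x y u v} → x ≤ y → u ≤ v → x + u ≤ y + v
  +-mono-≤ {y = y} {u = u} x≤y u≤v = ≤-trans (+-monoˡ-≤ u x≤y) (+-monoʳ-≤ y u≤v)

  +-cancelʳ : ∀ x z → (x + z) + - z ≈ x
  +-cancelʳ x z = ≈-trans (+-assoc x z (- z)) (≈-trans (+-congˡ (-‿inverseʳ z)) (+-identityʳ x))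

  +-cancelʳ-≤ : ∀ z {x y} → x + z ≤ y + z → x ≤ y
  +-cancelʳ-≤ z {x} {y} le =
    ≤-respˡ-≈ (+-cancelʳ x z) (≤-respʳ-≈ (+-cancelʳ y z) (+-monoˡ-≤ (- z) le))

  +-cancelˡ-≤ : ∀ z {x y} → z + x ≤ z + y → x ≤ y
  +-cancelˡ-≤ z {x} {y} le = +-cancelʳ-≤ z (≤-respˡ-≈ (+-comm z x) (≤-respʳ-≈ (+-comm z y) le))

  x≤x+y : ∀ {x y} → 0# ≤ y → x ≤ x + y
  x≤x+y {x} 0≤y = ≤-respˡ-≈ (+-identityʳ x) (+-monoʳ-≤ x 0≤y)

  x≤y+x : ∀ {x y} → 0# ≤ y → x ≤ y + x
  x≤y+x {x} 0≤y = ≤-respˡ-≈ (+-identityˡ x) (+-monoˡ-≤ x 0≤y)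

  x≤y⇒0≤y-x : ∀ {x y} → x ≤ y → 0# ≤ y - x
  x≤y⇒0≤y-x {x} x≤y = ≤-respˡ-≈ (-‿inverseʳ x) (+-monoˡ-≤ (- x) x≤y)

  y-x+x : ∀ y x → (y - x) + x ≈ y
  y-x+x y x = ≈-trans (+-assoc y (- x) x) (≈-trans (+-congˡ (-‿inverseˡ x)) (+-identityʳ y))

  *-monoˡ-≤ : ∀ {z x y} → 0# ≤ z → x ≤ y → x * z ≤ y * z
  *-monoˡ-≤ {z} {x} {y} 0≤z x≤y =
    ≤-respˡ-≈ (+-identityˡ (x * z)) (≤-respʳ-≈ eq
      (+-monoˡ-≤ (x * z) (*-nonneg (x≤y⇒0≤y-x x≤y) 0≤z)))
    where
    eq : (y - x) * z + x * z ≈ y * z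
    eq = ≈-trans (≈-sym (distribʳ z (y - x) x)) (*-congʳ (y-x+x y x))

  *-monoʳ-≤ : ∀ {z x y} → 0# ≤ z → x ≤ y → z * x ≤ z * y
  *-monoʳ-≤ {z} {x} {y} 0≤z x≤y =
    ≤-respˡ-≈ (*-comm x z) (≤-respʳ-≈ (*-comm y z) (*-monoˡ-≤ 0≤z x≤y))

  ≰⇒≥ : ∀ {x y} → ¬ (x ≤ y) → y ≤ x
  ≰⇒≥ {x} {y} x≰y = [ (λ x≤y → contradiction x≤y x≰y) , (λ y≤x → y≤x) ]′ (total x y)

  <⇒≱ : ∀ {x y} → x < y → ¬ (y ≤ x)
  <⇒≱ (x≤y , x≉y) y≤x = x≉y (antisym x≤y y≤x)

  ≰⇒> : ∀ {x y} → ¬ (x ≤ y) → y < x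
  ≰⇒> x≰y = ≰⇒≥ x≰y , λ y≈x → x≰y (≤-reflexive (≈-sym y≈x))

  <-≤-trans : ∀ {x y z} → x < y → y ≤ z → x < z
  <-≤-trans (x≤y , x≉y) y≤z =
    ≤-trans x≤y y≤z , λ x≈z → x≉y (antisym x≤y (≤-respʳ-≈ (≈-sym x≈z) y≤z))

  private
    *-inverse-cancel : ∀ {z} x → 0# < z → x * z * z ⁻¹ ≈ x
    *-inverse-cancel x 0<z =
      ≈-trans (*-assoc x _ _)
        (≈-trans (*-congˡ (*-inverseʳ (λ z≈0 → proj₂ 0<z (≈-sym z≈0)))) (*-identityʳ x))

  *-cancelʳ-≤ : ∀ {z x y} → 0# < z → x * z ≤ y * z → x ≤ y
  *-cancelʳ-≤ {z} {x} {y} 0<z xz≤yz with x ≤? y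
  ... | yes x≤y = x≤y
  ... | no  x≰y = ≤-reflexive (≈-trans (≈-sym (*-inverse-cancel x 0<z))
                    (≈-trans (*-congʳ xz≈yz) (*-inverse-cancel y 0<z)))
    where
    xz≈yz : x * z ≈ y * z
    xz≈yz = antisym xz≤yz (*-monoˡ-≤ (proj₁ 0<z) (≰⇒≥ x≰y))

  1+k*w : ∀ k w → (1# + k) * w ≈ w + k * w
  1+k*w k w = ≈-trans (distribʳ w 1# k) (+-congʳ (*-identityˡ w))

  x*z≤y⇒x≤y/z : ∀ {x y z} → 0# < z → x * z ≤ y → x ≤ y / z
  x*z≤y⇒x≤y/z {x} {y} {z} 0<z xz≤y = *-cancelʳ-≤ 0<z (≤-respʳ-≈ (≈-sym eq) xz≤y)
    where
    eq : y * z ⁻¹ * z ≈ y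
    eq = ≈-trans (*-assoc y _ z) (≈-trans (*-congˡ (*-comm _ z))
           (≈-trans (≈-sym (*-assoc y z _)) (*-inverse-cancel y 0<z)))

  0≤1 : 0# ≤ 1#
  0≤1 with total 0# 1#
  ... | inj₁ p = p
  ... | inj₂ 1≤0 = ≤-respʳ-≈ eq (*-nonneg 0≤-1 0≤-1)
    where
    0≤-1 : 0# ≤ - 1#
    0≤-1 = ≤-respʳ-≈ (+-identityˡ (- 1#)) (x≤y⇒0≤y-x 1≤0)
    eq : - 1# * - 1# ≈ 1#
    eq = ≈-trans (≈-sym (-‿distribˡ-* 1# (- 1#)))
           (≈-trans (-‿cong (*-identityˡ (- 1#))) (-‿involutive 1#))

  0<1 : 0# < 1#
  0<1 = 0≤1 , 0≉1

  fromℕ-+ : ∀ a b → fromℕ (a ℕ.+ b) ≈ fromℕ a + fromℕ b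
  fromℕ-+ = ×-homo-+ 1#

  0≤fromℕ : ∀ a → 0# ≤ fromℕ a
  0≤fromℕ zero    = ≤-refl
  0≤fromℕ (suc a) = ≤-trans 0≤1 (≤-respˡ-≈ (+-identityʳ 1#) (+-monoʳ-≤ 1# (0≤fromℕ a)))

  fromℕ-mono-≤ : ∀ {a b} → a ℕ.≤ b → fromℕ a ≤ fromℕ b
  fromℕ-mono-≤ {b = b} ℕ.z≤n = 0≤fromℕ b
  fromℕ-mono-≤ {suc a} {suc b} (ℕ.s≤s a≤b) = +-monoʳ-≤ 1# (fromℕ-mono-≤ {a} {b} a≤b)

  fromℕ-mono-< : ∀ {a b} → a ℕ.< b → fromℕ a < fromℕ b
  fromℕ-mono-< {a} a<b = <-≤-trans
    ( ≤-respˡ-≈ (+-identityˡ (fromℕ a)) (+-monoˡ-≤ (fromℕ a) 0≤1)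
    , λ a≈1+a → 0≉1 (≈-trans (≈-sym (-‿inverseʳ (fromℕ a)))
                     (≈-trans (+-congʳ a≈1+a) (+-cancelʳ 1# (fromℕ a)))))
    (fromℕ-mono-≤ {suc a} a<b)

  -- Natural numbers are compared in the field, since the distances live there.
  fromℕ-reflects-≤ : ∀ {a b} → fromℕ a ≤ fromℕ b → a ℕ.≤ b
  fromℕ-reflects-≤ {a} {b} le with a ℕ.≤? b
  ... | yes a≤b = a≤b
  ... | no  a≰b = contradiction le (<⇒≱ (fromℕ-mono-< {b} {a} (ℕ.≰⇒> a≰b)))

  fromℕ-double : ∀ a → fromℕ (a ℕ.+ a) ≈ (1# + 1#) * fromℕ a
  fromℕ-double a = ≈-trans (fromℕ-+ a a)
    (≈-sym (≈-trans (distribʳ (fromℕ a) 1# 1#) (+-cong (*-identityˡ _) (*-identityˡ _))))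

  log-mono-≤ : ∀ {x y} → 0# < x → x ≤ y → log x ≤ log y
  log-mono-≤ {x} {y} 0<x x≤y with x ≟ y
  ... | yes x≈y = ≤-reflexive (log-cong x≈y)
  ... | no  x≉y = proj₁ (log-< 0<x (x≤y , x≉y))

  log-1 : log 1# ≈ 0#
  log-1 = ≈-sym (≈-trans (≈-sym (-‿inverseʳ (log 1#)))
    (≈-trans (+-congʳ (≈-trans (log-cong (≈-sym (*-identityˡ 1#))) (log-* 0<1 0<1)))
             (+-cancelʳ (log 1#) (log 1#))))

-- Medians and the potential of a candidates' set

module Search {c ℓ₁ ℓ₂} (R : RealField c ℓ₁ ℓ₂) where
  open RealField R renaming (refl to ≈-refl; sym to ≈-sym; trans to ≈-trans)
  open OrderedField R
  open import Algebra.Properties.CommutativeSemigroup +-commutativeSemigroup using (interchange)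
  open DirectionSearch R

  module Distance {n} (G : Graph n) where
    open Graph G

    d≤len : ∀ {u v} (p : Walk u v) → d u v ≤ len p
    d≤len {u} {v} p = proj₂ (shortest u v) p

    0≤len : ∀ {u v} (p : Walk u v) → 0# ≤ len p
    0≤len [·]     = ≤-refl
    0≤len (e ◅ p) = ≤-respˡ-≈ (+-identityˡ 0#) (+-mono-≤ (proj₁ (weight-pos e)) (0≤len p))

    0≤d : ∀ u v → 0# ≤ d u v
    0≤d u v = 0≤len (proj₁ (shortest u v))

    len-◅◅ : ∀ {u v w} (p : Walk u v) (q : Walk v w) → len (p ◅◅ q) ≈ len p + len q
    len-◅◅ [·]     q = ≈-sym (+-identityˡ (len q))
    len-◅◅ (e ◅ p) q = ≈-trans (+-congˡ (len-◅◅ p q)) (≈-sym (+-assoc _ (len p) (len q)))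

    d-triangle : ∀ u v w → d u w ≤ d u v + d v w
    d-triangle u v w = ≤-respʳ-≈ (len-◅◅ p q) (d≤len (p ◅◅ q))
      where
      p = proj₁ (shortest u v)
      q = proj₁ (shortest v w)

    d≤weight : ∀ {u v} → Adj u v → d u v ≤ weight u v
    d≤weight e = ≤-respʳ-≈ (+-identityʳ _) (d≤len (e ◅ [·]))

    d≤weight+d : ∀ {u v} → Adj u v → ∀ x → d u x ≤ weight u v + d v x
    d≤weight+d {u} {v} e x = ≤-trans (d-triangle u v x) (+-monoˡ-≤ (d v x) (d≤weight e))

    lookup-N : ∀ v u x → lookup (N v u) x ≡ ⌊ d v x ≟ weight v u + d u x ⌋
    lookup-N v u x = Vec.lookup∘tabulate _ x

    -- The next two lemmas say that Γ S v is a least upper bound; they are all that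
    -- is used about its definition as a maximum over a list.
    ∣N∩∣≤Γ : ∀ S {v u} → Adj v u → ∣ N v u ∩ S ∣ ℕ.≤ Γ S v
    ∣N∩∣≤Γ S {v} {u} e = All.lookup (Extremaℕ.xs≤max 0 _)
      (∈-map⁺ (λ u → ∣ N v u ∩ S ∣) (∈-filter⁺ (adj? v) (∈-allFin u) e))

    Γ≤ : ∀ S v {b} → (∀ {u} → Adj v u → ∣ N v u ∩ S ∣ ℕ.≤ b) → Γ S v ℕ.≤ b
    Γ≤ S v bound = Extremaℕ.max≤v⁺ ℕ.z≤n
      (All.map⁺ (All.map bound (All.all-filter (adj? v) (allFin n))))

    median-bound : ∀ {ε S x} → 0# ≤ ε → IsMedian ε S x →
                   ∀ y → fromℕ (Γ S x) ≤ (1# + ε) * fromℕ (Γ S y)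
    median-bound {ε} {S} {x} 0≤ε med y =
      ≤-trans med (*-monoʳ-≤ 0≤1+ε (fromℕ-mono-≤
        (All.lookup (Extremaℕ.min≤xs (Γ S x) (map (Γ S) (allFin n))) (∈-map⁺ (Γ S) (∈-allFin y)))))
      where
      0≤1+ε : 0# ≤ 1# + ε
      0≤1+ε = ≤-respˡ-≈ (+-identityˡ 0#) (+-mono-≤ 0≤1 0≤ε)

    -- An exact minimiser is a (1+ε)-median for every ε, which is why a program that
    -- does not know ε can query medians.
    minimiser-isMedian : ∀ {ε S x} → 0# ≤ ε → (∀ y → Γ S x ℕ.≤ Γ S y) → IsMedian ε S x
    minimiser-isMedian {ε} {S} {x} 0≤ε minimal =
      ≤-trans (fromℕ-mono-≤ Γ≤min)
        (≤-respˡ-≈ (*-identityˡ _) (*-monoˡ-≤ (0≤fromℕ (Extremaℕ.min (Γ S x) (map (Γ S) (allFin n))))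
          (≤-respˡ-≈ (+-identityʳ 1#) (+-monoʳ-≤ 1# 0≤ε))))
      where
      Γ≤min : Γ S x ℕ.≤ Extremaℕ.min (Γ S x) (map (Γ S) (allFin n))
      Γ≤min = Extremaℕ.v≤min⁺ ℕ.≤-refl (All.map⁺ (All.universal minimal (allFin n)))

  0<∣S∣ : ∀ {n} {t : Fin n} {S} → t ∈ S → 0 ℕ.< ∣ S ∣
  0<∣S∣ t∈S = ℕ.≤-<-trans ℕ.z≤n (Subset.x∈p⇒∣p-x∣<∣p∣ t∈S)

  ∣S∣≡1⇒unique : ∀ {n} {S : Subset n} {t x} → ∣ S ∣ ≡ 1 → t ∈ S → x ∈ S → x ≡ t
  ∣S∣≡1⇒unique {S = S} {t} {x} ∣S∣≡1 t∈S x∈S with x Fin.≟ t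
  ... | yes x≡t = x≡t
  ... | no  x≢t = contradiction
    (ℕ.≤-<-trans (0<∣S∣ (Subset.x∈p∧x≢y⇒x∈p-y x∈S x≢t)) (Subset.x∈p⇒∣p-x∣<∣p∣ t∈S))
    (ℕ.≤⇒≯ (ℕ.≤-reflexive ∣S∣≡1))

  -- The sum of f over the elements of S.
  sumOver : ∀ {n} → Subset n → (Fin n → Carrier) → Carrier
  sumOver []          f = 0#
  sumOver (true  ∷ S) f = f Fin.zero + sumOver S (f ∘ Fin.suc)
  sumOver (false ∷ S) f = sumOver S (f ∘ Fin.suc)

  -- If f is smaller than g by at least w on N, and larger by at most w
  -- elsewhere, then summing over S gives
  -- sum f ≤ sum g - |N ∩ S| w + (|S| - |N ∩ S|) w, stated without subtraction.
  sumOver-shift : ∀ {n} (N S : Subset n) (f g : Fin n → Carrier) w →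
    (∀ x → lookup N x ≡ true  → f x + w ≤ g x) →
    (∀ x → lookup N x ≡ false → f x ≤ g x + w) →
    sumOver S f + fromℕ (∣ N ∩ S ∣ ℕ.+ ∣ N ∩ S ∣) * w ≤ sumOver S g + fromℕ ∣ S ∣ * w
  sumOver-shift [] [] f g w near far = ≤-refl
  sumOver-shift (true ∷ N) (false ∷ S) f g w near far =
    sumOver-shift N S _ _ w (near ∘ Fin.suc) (far ∘ Fin.suc)
  sumOver-shift (false ∷ N) (false ∷ S) f g w near far =
    sumOver-shift N S _ _ w (near ∘ Fin.suc) (far ∘ Fin.suc)
  sumOver-shift (false ∷ N) (true ∷ S) f g w near far =
    ≤-respˡ-≈ (≈-sym (+-assoc _ _ _)) (≤-respʳ-≈ eq
      (+-mono-≤ (far Fin.zero refl) (sumOver-shift N S _ _ w (near ∘ Fin.suc) (far ∘ Fin.suc))))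
    where
    eq : ∀ {a b k} → (a + w) + (b + k * w) ≈ (a + b) + (1# + k) * w
    eq {a} {b} {k} = ≈-trans (interchange a w b (k * w)) (+-congˡ (≈-sym (1+k*w k w)))
  sumOver-shift (true ∷ N) (true ∷ S) f g w near far =
    ≤-respˡ-≈ (eq₁ ∣ N ∩ S ∣) (≤-respʳ-≈ eq₂
      (+-mono-≤ (+-monoˡ-≤ w (near Fin.zero refl))
        (sumOver-shift N S _ _ w (near ∘ Fin.suc) (far ∘ Fin.suc))))
    where
    eq₁ : ∀ {a b} m → ((a + w) + w) + (b + fromℕ (m ℕ.+ m) * w)
                    ≈ (a + b) + fromℕ (suc m ℕ.+ suc m) * w
    eq₁ {a} {b} m rewrite ℕ.+-suc m m =
      ≈-trans (+-congʳ (+-assoc a w w)) (≈-trans (interchange a (w + w) b _)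
        (+-congˡ (≈-trans (+-assoc w w _) (≈-sym
          (≈-trans (1+k*w (1# + fromℕ (m ℕ.+ m)) w) (+-congˡ (1+k*w (fromℕ (m ℕ.+ m)) w)))))))
    eq₂ : ∀ {a b k} → (a + w) + (b + k * w) ≈ (a + b) + (1# + k) * w
    eq₂ {a} {b} {k} = ≈-trans (interchange a w b (k * w)) (+-congˡ (≈-sym (1+k*w k w)))

  module _ {n} (G : Graph n) where
    open Graph G
    open Distance G

    -- Some vertex has at most half of S in each of its directions.  The vertex v₀
    -- only witnesses that the graph is nonempty.
    half-median : Fin n → ∀ S → ∃ λ v → Γ S v ℕ.+ Γ S v ℕ.≤ ∣ S ∣
    half-median v₀ S = v , bound
      where
      open Extrema totalOrder using (argmin; f[argmin]≤f[xs])

      -- The sum of the distances to the elements of S.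
      Φ : Fin n → Carrier
      Φ v = sumOver S (d v)

      v : Fin n
      v = argmin Φ v₀ (allFin n)

      twice : ∀ {u} → Adj v u → ∣ N v u ∩ S ∣ ℕ.+ ∣ N v u ∩ S ∣ ℕ.≤ ∣ S ∣
      twice {u} e = fromℕ-reflects-≤ (*-cancelʳ-≤ (weight-pos e) (+-cancelˡ-≤ (Φ v)
        (≤-trans (+-monoˡ-≤ _ (All.lookup (f[argmin]≤f[xs] v₀ (allFin n)) (∈-allFin u)))
          (sumOver-shift (N v u) S (d u) (d v) (weight v u) near far))))
        where
        near : ∀ x → lookup (N v u) x ≡ true → d u x + weight v u ≤ d v x
        near x x∈N = ≤-reflexive (≈-trans (+-comm _ _) (≈-sym
          (toWitness (≡.subst T (≡.trans (≡.sym x∈N) (lookup-N v u x)) tt))))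
        far : ∀ x → lookup (N v u) x ≡ false → d u x ≤ d v x + weight v u
        far x _ = ≤-respʳ-≈ (≈-trans (+-comm _ _) (+-congˡ (weight-sym (adj-sym e))))
          (d≤weight+d (adj-sym e) x)

      bound : Γ S v ℕ.+ Γ S v ℕ.≤ ∣ S ∣
      bound = ℕ.≤-trans (ℕ.+-mono-≤ Γ≤half (ℕ.≤-trans Γ≤half (ℕ.⌊n/2⌋≤⌈n/2⌉ ∣ S ∣)))
                        (ℕ.≤-reflexive (ℕ.⌊n/2⌋+⌈n/2⌉≡n ∣ S ∣))
        where
        Γ≤half : Γ S v ℕ.≤ ℕ.⌊ ∣ S ∣ /2⌋
        Γ≤half = Γ≤ S v λ e →
          ℕ.≤-trans (ℕ.≤-reflexive (ℕ.n≡⌊n+n/2⌋ _)) (ℕ.⌊n/2⌋-mono (twice e))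

    -- All answers in the history are correct for the target t.
    Answered : Fin n → History n → Set
    Answered t = All (λ (v , r) → Correct G t v r)

    target∈candidates : ∀ {t h} → Answered t h → t ∈ candidates G h
    target∈candidates []                   = Subset.∈⊤
    target∈candidates (found _      ∷ ok) = target∈candidates ok
    target∈candidates (toward _ _ t∈ ∷ ok) = Subset.x∈p∩q⁺ (target∈candidates ok , t∈)

    detected? : ∀ h → Dec (Detected G h)
    detected? h = Any.any? found? h ⊎-dec (∣ candidates G h ∣ ℕ.≟ 1)
      where
      found? : (q : Fin n × Response n) → Dec (IsFound q)
      found? (v , found)    = yes found
      found? (v , toward u) = no λ ()

    2≤undetected : ∀ {t h} → Answered t h → ¬ Detected G h → 2 ℕ.≤ ∣ candidates G h ∣
    2≤undetected ok ¬det = ℕ.≤∧≢⇒< (0<∣S∣ (target∈candidates ok)) (λ 1≡ → ¬det (inj₂ (≡.sym 1≡)))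

    module Medians (ε : Carrier) (0≤ε : 0# ≤ ε) (ε<1 : ε < 1#) where

      ρ : Carrier
      ρ = 1# + ε

      1≤ρ : 1# ≤ ρ
      1≤ρ = ≤-respˡ-≈ (+-identityʳ 1#) (+-monoʳ-≤ 1# 0≤ε)

      0<ρ : 0# < ρ
      0<ρ = <-≤-trans 0<1 1≤ρ

      ρ<2 : ρ < 1# + 1#
      ρ<2 = +-monoʳ-≤ 1# (proj₁ ε<1) , λ eq →
        proj₂ ε<1 (antisym (proj₁ ε<1) (+-cancelˡ-≤ 1# (≤-reflexive (≈-sym eq))))

      0<2 : 0# < 1# + 1#
      0<2 = <-≤-trans 0<ρ (proj₁ ρ<2)

      -- The decrease of log |S| that a query at a (1+ε)-median guarantees.
      δ : Carrier
      δ = 1# - log ρ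

      0<δ : 0# < δ
      0<δ = x≤y⇒0≤y-x (proj₁ logρ<1) , λ 0≈δ → proj₂ logρ<1
        (≈-trans (≈-sym (+-identityˡ _)) (≈-trans (+-congʳ 0≈δ) (y-x+x 1# (log ρ))))
        where
        logρ<1 : log ρ < 1#
        logρ<1 = ≤-respʳ-≈ log-2 (proj₁ (log-< 0<ρ ρ<2))
               , λ eq → proj₂ (log-< 0<ρ ρ<2) (≈-trans eq (≈-sym log-2))

      0≤logρ : 0# ≤ log ρ
      0≤logρ = ≤-respˡ-≈ log-1 (log-mono-≤ 0<1 1≤ρ)

      δ≤1 : δ ≤ 1#
      δ≤1 = +-cancelʳ-≤ (log ρ) (≤-respˡ-≈ (≈-sym (y-x+x 1# (log ρ)))
              (≤-respˡ-≈ (+-identityʳ 1#) (+-monoʳ-≤ 1# 0≤logρ)))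

      -- The new candidates are at most Γ S v, which is at most ρ times the minimum of
      -- Γ S, which is at most half of |S|.
      shrink : ∀ {S v u} → IsMedian ε S v → Adj v u →
               (1# + 1#) * fromℕ ∣ S ∩ N v u ∣ ≤ ρ * fromℕ ∣ S ∣
      shrink {S} {v} {u} med e with half-median v S
      ... | y , ΓΓ≤S = ≤-trans (*-monoʳ-≤ (proj₁ 0<2) (≤-trans (fromℕ-mono-≤ S∩N≤Γ) (median-bound 0≤ε med y)))
          (≤-respˡ-≈ swap (*-monoʳ-≤ (proj₁ 0<ρ)
            (≤-respˡ-≈ (fromℕ-double (Γ S y)) (fromℕ-mono-≤ ΓΓ≤S))))
        where
        S∩N≤Γ : ∣ S ∩ N v u ∣ ℕ.≤ Γ S v
        S∩N≤Γ = ≡.subst (λ T → ∣ T ∣ ℕ.≤ Γ S v) (Subset.∩-comm (N v u) S) (∣N∩∣≤Γ S e)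
        swap : ρ * ((1# + 1#) * fromℕ (Γ S y)) ≈ (1# + 1#) * (ρ * fromℕ (Γ S y))
        swap = ≈-trans (≈-sym (*-assoc _ _ _)) (≈-trans (*-congʳ (*-comm _ _)) (*-assoc _ _ _))

      shrink-< : ∀ {S v u} {t : Fin n} → t ∈ S → IsMedian ε S v → Adj v u → ∣ S ∩ N v u ∣ ℕ.< ∣ S ∣
      shrink-< {S} {v} {u} t∈S med e = ℕ.≰⇒> λ S≤S′ →
        <⇒≱ ρ<2 (*-cancelʳ-≤ (fromℕ-mono-< (0<∣S∣ t∈S))
          (≤-trans (*-monoʳ-≤ (proj₁ 0<2) (fromℕ-mono-≤ S≤S′)) (shrink med e)))

      shrink-log : ∀ {S v u} {t : Fin n} → t ∈ S → t ∈ N v u → IsMedian ε S v → Adj v u →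
                   δ + log (fromℕ ∣ S ∩ N v u ∣) ≤ log (fromℕ ∣ S ∣)
      shrink-log {S} {v} {u} t∈S t∈N med e = +-cancelˡ-≤ (log ρ)
        (≤-respˡ-≈ eq₁ (≤-respʳ-≈ (log-* 0<ρ 0<S)
          (log-mono-≤ 0<2S′ (shrink med e))))
        where
        0<S : 0# < fromℕ ∣ S ∣
        0<S = fromℕ-mono-< (0<∣S∣ t∈S)
        S′ = fromℕ ∣ S ∩ N v u ∣
        0<S′ : 0# < S′
        0<S′ = fromℕ-mono-< (0<∣S∣ (Subset.x∈p∩q⁺ (t∈S , t∈N)))
        0<2S′ : 0# < (1# + 1#) * S′
        0<2S′ = <-≤-trans 0<S′ (≤-respˡ-≈ (*-identityˡ S′)
          (*-monoˡ-≤ (proj₁ 0<S′) (≤-trans 1≤ρ (proj₁ ρ<2))))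
        eq₁ : log ((1# + 1#) * S′) ≈ log ρ + (δ + log S′)
        eq₁ = ≈-trans (log-* 0<2 0<S′) (≈-trans (+-congʳ (≈-trans log-2
          (≈-trans (≈-sym (y-x+x 1# (log ρ))) (+-comm δ (log ρ))))) (+-assoc _ _ _))

      suc-* : ∀ k x → fromℕ (suc k) * x ≈ fromℕ k * x + x
      suc-* k x = ≈-trans (1+k*w (fromℕ k) x) (+-comm _ _)

      -- Each answered query lowers log |S| by at least δ, from log n at the start.
      potential : ∀ {t h} → Answered t h → MedianHistory G ε h → ¬ Any IsFound h →
                  fromℕ (length h) * δ + log (fromℕ ∣ candidates G h ∣) ≤ log (fromℕ n)
      potential [] [] _ = ≤-reflexive (≈-trans (+-cong (zeroˡ δ)
        (log-cong (reflexive (≡.cong fromℕ (Subset.∣⊤∣≡n n))))) (+-identityˡ _))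
      potential (found _ ∷ ok) (query _ _ _) ¬found = contradiction (here found) ¬found
      potential {h = _ ∷ h} (toward _ e t∈N ∷ ok) (query _ med mh) ¬found = ≤-trans
        (≤-respˡ-≈ (≈-sym (≈-trans (+-congʳ (suc-* (length h) δ)) (+-assoc _ _ _)))
          (+-monoʳ-≤ _ (shrink-log (target∈candidates ok) t∈N med e)))
        (potential ok mh (¬found ∘ there))

      log-∣∣ : ∀ {k m} → 0 ℕ.< k → k ℕ.≤ m → log (fromℕ k) ≤ log (fromℕ m)
      log-∣∣ 0<k k≤m = log-mono-≤ (fromℕ-mono-< 0<k) (fromℕ-mono-≤ k≤m)

      -- The last query was made with at least two candidates.  Their logarithm, at
      -- least 1, pays for it, whatever its answer was.
      paid : ∀ {t h} → Answered t h → MedianHistory G ε h → fromℕ (length h) * δ ≤ log (fromℕ n)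
      paid {t} {h = []} ok mh = ≤-respˡ-≈ (≈-sym (zeroˡ δ))
        (≤-respˡ-≈ (≈-trans (log-cong (+-identityʳ 1#)) log-1)
          (log-∣∣ (ℕ.s≤s ℕ.z≤n) (ℕ.≤-trans (ℕ.s≤s ℕ.z≤n) (Fin.toℕ<n t))))
      paid {h = q ∷ h} (a ∷ ok) (query ¬det _ mh) =
        ≤-trans (≤-respˡ-≈ (≈-sym (suc-* (length h) δ)) (+-monoʳ-≤ _ δ≤log))
                (potential ok mh (¬det ∘ inj₁))
        where
        δ≤log : δ ≤ log (fromℕ ∣ candidates G h ∣)
        δ≤log = ≤-trans δ≤1 (≤-respˡ-≈ (≈-trans (log-cong (+-congˡ (+-identityʳ 1#))) log-2)
          (log-∣∣ (ℕ.s≤s ℕ.z≤n) (2≤undetected ok ¬det)))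

      medians-within-bound : ∀ {t h} → Answered t h → MedianHistory G ε h →
                             fromℕ (length h) ≤ queryBound n ε
      medians-within-bound ok mh = x*z≤y⇒x≤y/z 0<δ (paid ok mh)

      answer-progress : ∀ {t h v r} → Answered t h → Correct G t v r → IsMedian ε (candidates G h) v →
        Any IsFound ((v , r) ∷ h) ⊎ ∣ candidates G ((v , r) ∷ h) ∣ ℕ.< ∣ candidates G h ∣
      answer-progress ok (found _)      med = inj₁ (here found)
      answer-progress ok (toward _ e _) med = inj₂ (shrink-< (target∈candidates ok) med e)

      module _ {t} {O : Responder n} (truthful : Truthful G t O)
               {σ : Strategy n} (medians : QueriesMedians G ε O σ) where

        play-answered : ∀ k → Answered t (play σ O k)
        play-answered zero    = []
        play-answered (suc k) = truthful _ _ ∷ play-answered k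

        length-play : ∀ k → length (play σ O k) ≡ k
        length-play zero    = refl
        length-play (suc k) = ≡.cong suc (length-play k)

        -- The play so far queried medians, and each query removed a candidate.
        Progress : ℕ → Set ℓ₂
        Progress k = MedianHistory G ε (play σ O k) × ∣ candidates G (play σ O k) ∣ ℕ.+ k ℕ.≤ n

        -- Within k queries, either the target is detected or at least k candidates
        -- are gone.
        search : ∀ k → (∃ λ j → MedianHistory G ε (play σ O j) × Detected G (play σ O j)) ⊎ Progress k
        search zero = inj₂ ([] , ℕ.≤-reflexive (≡.trans (ℕ.+-identityʳ _) (Subset.∣⊤∣≡n n)))
        search (suc k) with search k
        ... | inj₁ done = inj₁ done
        ... | inj₂ (mh , left) with detected? (play σ O k)
        ... | yes det = inj₁ (k , mh , det)
        ... | no ¬det with answer-progress (play-answered k) (truthful _ _) (medians k ¬det)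
        ... | inj₁ fnd  = inj₁ (suc k , query ¬det (medians k ¬det) mh , inj₁ fnd)
        ... | inj₂ less = inj₂ (query ¬det (medians k ¬det) mh
              , ℕ.≤-trans (ℕ.≤-reflexive (ℕ.+-suc _ k)) (ℕ.≤-trans (ℕ.+-monoˡ-≤ k less) left))

        detects : ∃ λ k → Detected G (play σ O k) × fromℕ k ≤ queryBound n ε
        detects with search n
        ... | inj₁ (k , mh , det) = k , det
            , ≡.subst (λ m → fromℕ m ≤ queryBound n ε) (length-play k)
                (medians-within-bound (play-answered k) mh)
        ... | inj₂ (_ , left) = contradiction left (ℕ.<⇒≱
            (ℕ.+-monoˡ-≤ n (0<∣S∣ (target∈candidates (play-answered n)))))

-- Reasoning about programs

module Machine {c ℓ₁ ℓ₂} (R : RealField c ℓ₁ ℓ₂) where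
  open DirectionSearch R
  open RealField R using (Carrier)

  -- A loop whose number of iterations is the number of vertices.
  for : Array → Program → Program
  for a p = loop a (0 [ lit 0 , lit 0 ]) p

  -- Whether an array of naturals, or of weights, occurs as a target of a program.
  writesⁿ : Program → Array → Bool
  writesⁿ skip              a = false
  writesⁿ (b [ _ , _ ]≔ⁿ _) a = b ≡ᵇ a
  writesⁿ (_ [ _ , _ ]≔ʷ _) a = false
  writesⁿ (p ⨾ q)           a = writesⁿ p a ∨ writesⁿ q a
  writesⁿ (cond _ p q)      a = writesⁿ p a ∨ writesⁿ q a
  writesⁿ (loop b _ p)      a = (b ≡ᵇ a) ∨ writesⁿ p a
  writesⁿ (query _ b)       a = b ≡ᵇ a

  writesʷ : Program → Array → Bool
  writesʷ skip              a = false
  writesʷ (_ [ _ , _ ]≔ⁿ _) a = false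
  writesʷ (b [ _ , _ ]≔ʷ _) a = b ≡ᵇ a
  writesʷ (p ⨾ q)           a = writesʷ p a ∨ writesʷ q a
  writesʷ (cond _ p q)      a = writesʷ p a ∨ writesʷ q a
  writesʷ (loop _ _ p)      a = writesʷ p a
  writesʷ (query _ _)       a = false

  queries : Program → Bool
  queries skip              = false
  queries (_ [ _ , _ ]≔ⁿ _) = false
  queries (_ [ _ , _ ]≔ʷ _) = false
  queries (p ⨾ q)           = queries p ∨ queries q
  queries (cond _ p q)      = queries p ∨ queries q
  queries (loop _ _ p)      = queries p
  queries (query _ _)       = true

  -- The configuration s′ differs from s only in arrays that p writes to, and in
  -- the history only if p queries.  Nothing is said about the running time.
  record Frame {n} (p : Program) (s s′ : Config n) : Set c where
    field
      nats≡    : ∀ a → writesⁿ p a ≡ false → ∀ i j → nats s′ a i j ≡ nats s a i j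
      weights≡ : ∀ a → writesʷ p a ≡ false → ∀ i j → weights s′ a i j ≡ weights s a i j
      history≡ : queries p ≡ false → history s′ ≡ history s
  open Frame public

  private
    ∨-falseˡ : ∀ x {y} → x ∨ y ≡ false → x ≡ false
    ∨-falseˡ x {y} = Bool.∨-conicalˡ x y
    ∨-falseʳ : ∀ x {y} → x ∨ y ≡ false → y ≡ false
    ∨-falseʳ x {y} = Bool.∨-conicalʳ x y

  store-other : ∀ {a} {A : Set a} b b′ i j (x : A) m → (b ≡ᵇ b′) ≡ false →
                ∀ i′ j′ → store b i j x m b′ i′ j′ ≡ m b′ i′ j′
  store-other b b′ i j x m b≢b′ i′ j′ rewrite b≢b′ = refl

  ≡ᵇ-refl : ∀ i → (i ≡ᵇ i) ≡ true
  ≡ᵇ-refl zero    = refl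
  ≡ᵇ-refl (suc i) = ≡ᵇ-refl i

  store-same : ∀ {a} {A : Set a} b i j (x : A) m → store b i j x m b i j ≡ x
  store-same b i j x m rewrite ≡ᵇ-refl b | ≡ᵇ-refl i | ≡ᵇ-refl j = refl

  -- A cell of the array written to is either the written cell or unchanged.
  store-cases : ∀ {a} {A : Set a} b i j (x : A) m i′ j′ →
    (i ≡ i′ × j ≡ j′ × store b i j x m b i′ j′ ≡ x) ⊎ store b i j x m b i′ j′ ≡ m b i′ j′
  store-cases b i j x m i′ j′ rewrite ≡ᵇ-refl b
    with i ≡ᵇ i′ in eqᵢ | j ≡ᵇ j′ in eqⱼ
  ... | false | _     = inj₂ refl
  ... | true  | false = inj₂ refl
  ... | true  | true  = inj₁ ( ℕ.≡ᵇ⇒≡ i i′ (≡.subst T (≡.sym eqᵢ) tt)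
                             , ℕ.≡ᵇ⇒≡ j j′ (≡.subst T (≡.sym eqⱼ) tt) , refl)

  module _ {n} (O : Responder n) where

    -- The configuration in which the body of a loop starts its iteration i.
    enter : Array → ℕ → Config n → Config n
    enter a i s = tick O (storeⁿ O a 0 0 i s)

    frame-refl : ∀ {p s} → Frame p s (tick O s)
    frame-refl = record { nats≡ = λ _ _ _ _ → refl ; weights≡ = λ _ _ _ _ → refl ; history≡ = λ _ → refl }

    frame-trans : ∀ {p} {s s′ s″ : Config n} → Frame p s s′ → Frame p s′ s″ → Frame p s s″
    frame-trans f g = record
      { nats≡    = λ a w i j → ≡.trans (nats≡ g a w i j) (nats≡ f a w i j)
      ; weights≡ = λ a w i j → ≡.trans (weights≡ g a w i j) (weights≡ f a w i j)
      ; history≡ = λ q → ≡.trans (history≡ g q) (history≡ f q)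
      }

    frame-weaken : ∀ {p q} {s s′ : Config n} →
      (∀ a → writesⁿ q a ≡ false → writesⁿ p a ≡ false) →
      (∀ a → writesʷ q a ≡ false → writesʷ p a ≡ false) →
      (queries q ≡ false → queries p ≡ false) →
      Frame p s s′ → Frame q s s′
    frame-weaken n⊆ w⊆ q⊆ f = record
      { nats≡    = λ a w → nats≡ f a (n⊆ a w)
      ; weights≡ = λ a w → weights≡ f a (w⊆ a w)
      ; history≡ = λ q → history≡ f (q⊆ q)
      }

    frame-enter : ∀ a i {e p s} → Frame (loop a e p) s (enter a i s)
    frame-enter a i {s = s} = record
      { nats≡    = λ b w → store-other a b 0 0 i (nats s) (∨-falseˡ (a ≡ᵇ b) w)
      ; weights≡ = λ _ _ _ _ → refl
      ; history≡ = λ _ → refl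
      }

    frame-body : ∀ {a e p} {s s′ : Config n} → Frame p s s′ → Frame (loop a e p) s s′
    frame-body {a} = frame-weaken (λ b → ∨-falseʳ (a ≡ᵇ b)) (λ _ w → w) (λ q → q)

    frame-⨾ : ∀ {p q} {s s′ s″ : Config n} → Frame p s s′ → Frame q s′ s″ → Frame (p ⨾ q) s s″
    frame-⨾ {p} f g = frame-trans
      (frame-weaken (λ a → ∨-falseˡ (writesⁿ p a)) (λ a → ∨-falseˡ (writesʷ p a)) (∨-falseˡ (queries p)) f)
      (frame-weaken (λ a → ∨-falseʳ (writesⁿ p a)) (λ a → ∨-falseʳ (writesʷ p a)) (∨-falseʳ (queries p)) g)

    frame : ∀ p s → Frame p s (exec O p s)
    frame skip s = frame-refl
    frame (a [ e , f ]≔ⁿ g) s = record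
      { nats≡    = λ b w → store-other a b (evalⁿ O e s) (evalⁿ O f s) (evalⁿ O g s) (nats s) w
      ; weights≡ = λ _ _ _ _ → refl ; history≡ = λ _ → refl }
    frame (a [ e , f ]≔ʷ g) s = record
      { nats≡    = λ _ _ _ _ → refl
      ; weights≡ = λ b w → store-other a b (evalⁿ O e s) (evalⁿ O f s) (evalʷ O g s) (weights s) w
      ; history≡ = λ _ → refl }
    frame (p ⨾ q) s = frame-⨾ (frame p s) (frame q (exec O p s))
    frame (cond b p q) s with test O b s
    ... | true  = frame-trans frame-refl
      (frame-weaken (λ a → ∨-falseˡ (writesⁿ p a)) (λ a → ∨-falseˡ (writesʷ p a)) (∨-falseˡ (queries p))
        (frame p (tick O s)))
    ... | false = frame-trans frame-refl
      (frame-weaken (λ a → ∨-falseʳ (writesⁿ p a)) (λ a → ∨-falseʳ (writesʷ p a)) (∨-falseʳ (queries p))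
        (frame q (tick O s)))
    frame (loop a e p) s = frame-iterate (evalⁿ O e s)
      where
      frame-iterate : ∀ k → Frame (loop a e p) s
        (iterate O (λ i s′ → exec O p (enter a i s′)) k (tick O s))
      frame-iterate zero    = frame-refl
      frame-iterate (suc k) = frame-trans (frame-iterate k)
        (frame-trans (frame-enter a k) (frame-body (frame p _)))
    frame (query e a) s with evalⁿ O e s ℕ.<? n
    ... | yes _ = record
      { nats≡    = λ b w → store-other a b 0 0 _ (nats s) w
      ; weights≡ = λ _ _ _ _ → refl
      ; history≡ = λ () }
    ... | no  _ = frame-refl

    -- The invariant rule.  An invariant has to hold after tick and be preserved by
    -- enter; for most invariants both hold by computation, as the counter and the
    -- running time are all that changes.  The body is only treated for an index in
    -- Fin n, and in a configuration framed by the whole loop.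
    for-rule : ∀ {ℓ} a p s → nats s 0 0 0 ≡ n → (J : ℕ → Config n → Set ℓ) →
      J 0 (tick O s) →
      (∀ i s′ → J i s′ → J i (enter a i s′)) →
      (∀ (i : Fin n) s′ → Frame (for a p) s s′ → nats s′ a 0 0 ≡ toℕ i →
       J (toℕ i) s′ → J (suc (toℕ i)) (exec O p s′)) →
      J n (exec O (for a p) s)
    for-rule a p s size J base stable step =
      ≡.subst (λ k → J k (exec O (for a p) s)) size (proj₁ (go (nats s 0 0 0) (ℕ.≤-reflexive size)))
      where
      -- The loop is unrolled for the n iterations fixed on entry.
      go : ∀ k → k ℕ.≤ n →
           let s′ = iterate O (λ i s′ → exec O p (enter a i s′)) k (tick O s) in
           J k s′ × Frame (for a p) s s′
      go zero    _   = base , frame-refl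
      go (suc k) k<n with go k (ℕ.<⇒≤ k<n)
      ... | Jk , f = ≡.subst (λ k → J (suc k) (exec O p s″)) eq
                       (step i s″ f″ (≡.trans (store-same a 0 0 k (nats s′)) (≡.sym eq))
                         (≡.subst (λ k → J k s″) (≡.sym eq) (stable k s′ Jk)))
                   , frame-trans f″ (frame-body (frame p s″))
        where
        i  = fromℕ< k<n
        eq = Fin.toℕ-fromℕ< k<n
        s′ = iterate O (λ i s′ → exec O p (enter a i s′)) k (tick O s)
        s″ = enter a k s′
        f″ : Frame (for a p) s s″
        f″ = frame-trans f (frame-enter a k)

    -- A loop which makes Q i true in iteration i, and does not invalidate Q j for
    -- other j, makes Q true everywhere.  The invariant I holds throughout.
    for-each : ∀ {ℓ ℓ′} a p s → nats s 0 0 0 ≡ n →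
      (I : Config n → Set ℓ) (Q : Fin n → Config n → Set ℓ′) →
      I (tick O s) →
      (∀ i s′ → I s′ → I (enter a i s′)) →
      (∀ j i s′ → Q j s′ → Q j (enter a i s′)) →
      (∀ i s′ → Frame (for a p) s s′ → nats s′ a 0 0 ≡ toℕ i → I s′ →
       I (exec O p s′) × Q i (exec O p s′) × (∀ j → j ≢ i → Q j s′ → Q j (exec O p s′))) →
      I (exec O (for a p) s) × (∀ j → Q j (exec O (for a p) s))
    for-each a p s size I Q base stableI stableQ treat
      with for-rule a p s size (λ k s′ → I s′ × (∀ j → toℕ j ℕ.< k → Q j s′))
        (base , λ _ ())
        (λ i s′ (inv , done) → stableI i s′ inv , λ j j<i → stableQ j i s′ (done j j<i))
        step
      where
      step : ∀ i s′ → Frame (for a p) s s′ → nats s′ a 0 0 ≡ toℕ i →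
             I s′ × (∀ j → toℕ j ℕ.< toℕ i → Q j s′) →
             I (exec O p s′) × (∀ j → toℕ j ℕ.< suc (toℕ i) → Q j (exec O p s′))
      step i s′ f at-i (inv , done) with treat i s′ f at-i inv
      ... | inv′ , new , keep = inv′ , λ j j<1+i → done′ j (ℕ.s≤s⁻¹ j<1+i)
        where
        done′ : ∀ j → toℕ j ℕ.≤ toℕ i → Q j (exec O p s′)
        done′ j j≤i with j Fin.≟ i
        ... | yes refl = new
        ... | no  j≢i  = keep j j≢i (done j (ℕ.≤∧≢⇒< j≤i (j≢i ∘ Fin.toℕ-injective)))
    ... | inv , done = inv , λ j → done j (Fin.toℕ<n j)

    cond-rule : ∀ {ℓ} b p q s (Q : Config n → Set ℓ) →
      (test O b s ≡ true  → Q (exec O p (tick O s))) →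
      (test O b s ≡ false → Q (exec O q (tick O s))) →
      Q (exec O (cond b p q) s)
    cond-rule b p q s Q yes-case no-case with test O b s
    ... | true  = yes-case refl
    ... | false = no-case refl

    -- A query at the number of a vertex is a query at this vertex.
    query-at : ∀ e a s v → evalⁿ O e s ≡ toℕ v → exec O (query e a) s ≡ ask O a v (tick O s)
    query-at e a s v eq with evalⁿ O e s ℕ.<? n
    ... | yes e<n = ≡.cong (λ v → ask O a v (tick O s))
                      (≡.trans (Fin.fromℕ<-cong _ _ eq e<n (Fin.toℕ<n v)) (Fin.fromℕ<-toℕ v (Fin.toℕ<n v)))
    ... | no  e≮n = contradiction (≡.subst (ℕ._< n) (≡.sym eq) (Fin.toℕ<n v)) e≮n

  -- All loops of the program have as many iterations as the graph has vertices.
  Bounded : Program → Set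
  Bounded skip              = Unit
  Bounded (_ [ _ , _ ]≔ⁿ _) = Unit
  Bounded (_ [ _ , _ ]≔ʷ _) = Unit
  Bounded (p ⨾ q)           = Bounded p × Bounded q
  Bounded (cond _ p q)      = Bounded p × Bounded q
  Bounded (loop a e p)      = e ≡ 0 [ lit 0 , lit 0 ] × Bounded p
  Bounded (query _ _)       = Unit

  -- A bound on the running time of a program all of whose loops have n iterations.
  steps : ℕ → Program → ℕ
  steps n skip              = 1
  steps n (_ [ _ , _ ]≔ⁿ _) = 1
  steps n (_ [ _ , _ ]≔ʷ _) = 1
  steps n (p ⨾ q)           = steps n p ℕ.+ steps n q
  steps n (cond _ p q)      = suc (steps n p ℕ.+ steps n q)
  steps n (loop _ _ p)      = suc (n ℕ.* suc (steps n p))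
  steps n (query _ _)       = 1

  -- The coefficient and the exponent of a polynomial bound on steps.
  size depth : Program → ℕ
  size skip              = 1
  size (_ [ _ , _ ]≔ⁿ _) = 1
  size (_ [ _ , _ ]≔ʷ _) = 1
  size (p ⨾ q)           = size p ℕ.+ size q
  size (cond _ p q)      = suc (size p ℕ.+ size q)
  size (loop _ _ p)      = suc (suc (size p))
  size (query _ _)       = 1

  depth skip              = 0
  depth (_ [ _ , _ ]≔ⁿ _) = 0
  depth (_ [ _ , _ ]≔ʷ _) = 0
  depth (p ⨾ q)           = depth p ℕ.⊔ depth q
  depth (cond _ p q)      = depth p ℕ.⊔ depth q
  depth (loop _ _ p)      = suc (depth p)
  depth (query _ _)       = 0

  module _ {n} (O : Responder n) where

    -- The program must not overwrite the number of vertices, in array 0.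
    time-≤ : ∀ p s → Bounded p → nats s 0 0 0 ≡ n → writesⁿ p 0 ≡ false →
             time (exec O p s) ℕ.≤ time s ℕ.+ steps n p
    time-≤ skip s _ _ _ = ℕ.≤-reflexive (≡.sym (ℕ.+-comm (time s) 1))
    time-≤ (_ [ _ , _ ]≔ⁿ _) s _ _ _ = ℕ.≤-reflexive (≡.sym (ℕ.+-comm (time s) 1))
    time-≤ (_ [ _ , _ ]≔ʷ _) s _ _ _ = ℕ.≤-reflexive (≡.sym (ℕ.+-comm (time s) 1))
    time-≤ (p ⨾ q) s (bp , bq) sz w = begin
      time (exec O q (exec O p s))              ≤⟨ time-≤ q (exec O p s) bq (≡.trans (nats≡ (frame O p s) 0 wp 0 0) sz) wq ⟩
      time (exec O p s) ℕ.+ steps n q           ≤⟨ ℕ.+-monoˡ-≤ (steps n q) (time-≤ p s bp sz wp) ⟩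
      time s ℕ.+ steps n p ℕ.+ steps n q        ≡⟨ ℕ.+-assoc (time s) (steps n p) (steps n q) ⟩
      time s ℕ.+ (steps n p ℕ.+ steps n q)      ∎
      where
      open ℕ.≤-Reasoning
      wp = ∨-falseˡ (writesⁿ p 0) w
      wq = ∨-falseʳ (writesⁿ p 0) w
    time-≤ (cond b p q) s (bp , bq) sz w with test O b s
    ... | true  = ℕ.≤-trans (time-≤ p (tick O s) bp sz (∨-falseˡ (writesⁿ p 0) w))
      (ℕ.≤-trans (ℕ.≤-reflexive (≡.sym (ℕ.+-suc (time s) _)))
        (ℕ.+-monoʳ-≤ (time s) (ℕ.s≤s (ℕ.m≤m+n _ _))))
    ... | false = ℕ.≤-trans (time-≤ q (tick O s) bq sz (∨-falseʳ (writesⁿ p 0) w))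
      (ℕ.≤-trans (ℕ.≤-reflexive (≡.sym (ℕ.+-suc (time s) _)))
        (ℕ.+-monoʳ-≤ (time s) (ℕ.s≤s (ℕ.m≤n+m _ _))))
    time-≤ (loop a e p) s (refl , bp) sz w =
      ℕ.≤-trans (go (nats s 0 0 0)) (ℕ.≤-reflexive (≡.cong (λ k → time s ℕ.+ suc (k ℕ.* suc S)) sz))
      where
      S = steps n p
      -- A loop cut off after k iterations is a loop with a literal bound.
      go : ∀ k → time (exec O (loop a (lit k) p) s) ℕ.≤ time s ℕ.+ suc (k ℕ.* suc S)
      go zero    = ℕ.≤-reflexive (≡.sym (ℕ.+-comm (time s) 1))
      go (suc k) = begin
        time (exec O p s″)                               ≤⟨ time-≤ p s″ bp sz″ (∨-falseʳ (a ≡ᵇ 0) w) ⟩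
        suc (time s′) ℕ.+ S                              ≤⟨ ℕ.+-monoˡ-≤ S (ℕ.s≤s (go k)) ⟩
        suc (time s ℕ.+ suc (k ℕ.* suc S)) ℕ.+ S         ≡⟨ rearrange (time s) S (k ℕ.* suc S) ⟩
        time s ℕ.+ suc (suc k ℕ.* suc S)                 ∎
        where
        open ℕ.≤-Reasoning
        s′ = exec O (loop a (lit k) p) s
        s″ = enter O a k s′
        sz″ : nats s″ 0 0 0 ≡ n
        sz″ = ≡.trans (nats≡ (frame-enter O a k {e = lit k} {p} {s′}) 0 w 0 0)
              (≡.trans (nats≡ (frame O (loop a (lit k) p) s) 0 w 0 0) sz)
        rearrange : ∀ t S x → suc (t ℕ.+ suc x) ℕ.+ S ≡ t ℕ.+ suc (suc S ℕ.+ x)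
        rearrange = solve-∀
    time-≤ (query e a) s _ _ _ with evalⁿ O e s ℕ.<? n
    ... | yes _ = ℕ.≤-reflexive (≡.sym (ℕ.+-comm (time s) 1))
    ... | no  _ = ℕ.≤-reflexive (≡.sym (ℕ.+-comm (time s) 1))

  steps-≤ : ∀ n → .{{ℕ.NonZero n}} → ∀ p → steps n p ℕ.≤ size p ℕ.* n ^ depth p
  steps-≤ n p = go p
    where
    open ℕ.≤-Reasoning
    1≤n^ : ∀ k → 1 ℕ.≤ n ^ k
    1≤n^ k = ℕ.>-nonZero⁻¹ (n ^ k) {{ℕ.m^n≢0 n k}}
    ^-mono : ∀ {j k} → j ℕ.≤ k → n ^ j ℕ.≤ n ^ k
    ^-mono = ℕ.^-monoʳ-≤ n
    go : ∀ p → steps n p ℕ.≤ size p ℕ.* n ^ depth p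
    both : ∀ p q → steps n p ℕ.+ steps n q ℕ.≤ (size p ℕ.+ size q) ℕ.* n ^ (depth p ℕ.⊔ depth q)
    both p q = begin
      steps n p ℕ.+ steps n q ≤⟨ ℕ.+-mono-≤ (go p) (go q) ⟩
      size p ℕ.* n ^ depth p ℕ.+ size q ℕ.* n ^ depth q
        ≤⟨ ℕ.+-mono-≤ (ℕ.*-monoʳ-≤ (size p) (^-mono (ℕ.m≤m⊔n (depth p) (depth q))))
                      (ℕ.*-monoʳ-≤ (size q) (^-mono (ℕ.m≤n⊔m (depth p) (depth q)))) ⟩
      size p ℕ.* n ^ (depth p ℕ.⊔ depth q) ℕ.+ size q ℕ.* n ^ (depth p ℕ.⊔ depth q)
        ≡⟨ ≡.sym (ℕ.*-distribʳ-+ (n ^ (depth p ℕ.⊔ depth q)) (size p) (size q)) ⟩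
      (size p ℕ.+ size q) ℕ.* n ^ (depth p ℕ.⊔ depth q) ∎
    go skip              = ℕ.≤-refl
    go (_ [ _ , _ ]≔ⁿ _) = ℕ.≤-refl
    go (_ [ _ , _ ]≔ʷ _) = ℕ.≤-refl
    go (p ⨾ q)           = both p q
    go (cond _ p q)      = ℕ.+-mono-≤ (1≤n^ (depth p ℕ.⊔ depth q)) (both p q)
    go (loop _ _ p)      = begin
      suc (n ℕ.* suc (steps n p))
        ≤⟨ ℕ.+-mono-≤ (1≤n^ (suc (depth p))) (ℕ.*-monoʳ-≤ n (ℕ.+-mono-≤ (1≤n^ (depth p)) (go p))) ⟩
      n ^ suc (depth p) ℕ.+ n ℕ.* (suc (size p) ℕ.* n ^ depth p)
        ≡⟨ rearrange n (size p) (n ^ depth p) ⟩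
      suc (suc (size p)) ℕ.* n ^ suc (depth p) ∎
      where
      rearrange : ∀ n s x → n ℕ.* x ℕ.+ n ℕ.* (suc s ℕ.* x) ≡ suc (suc s) ℕ.* (n ℕ.* x)
      rearrange = solve-∀
    go (query _ _)       = ℕ.≤-refl

-- All distances, by the algorithm of Floyd and Warshall

module Paths {c ℓ₁ ℓ₂} (R : RealField c ℓ₁ ℓ₂) where
  open RealField R renaming (refl to ≈-refl; sym to ≈-sym; trans to ≈-trans)
  open OrderedField R
  open import Algebra.Properties.CommutativeSemigroup +-commutativeSemigroup using (interchange)
  open DirectionSearch R
  open Machine R
  open Search R

  -- Arrays of naturals: the adjacency matrix, the flags of the entries of the
  -- distance table, and the three loop counters.
  adjacency reached row column middle : Array
  adjacency = 1
  reached   = 3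
  row       = 4
  column    = 5
  middle    = 6

  -- Arrays of weights: the weight matrix and the distance table.
  edge dist : Array
  edge = 0
  dist = 1

  -- The cell in which loop counters and single numbers are kept.
  scalar : Array → NatExp
  scalar a = a [ lit 0 , lit 0 ]

  recorded : Test
  recorded = lit 1 ≤ⁿ reached [ scalar row , scalar column ]

  noLonger : WeightExp → Test
  noLonger e = dist [ scalar row , scalar column ] ≤ʷ e

  -- relax e enters the weight e in the table at (row, column), unless the value
  -- there is at most e already.
  setDist shorten discover relax : WeightExp → Program
  setDist  e = dist [ scalar row , scalar column ]≔ʷ e
  shorten  e = cond (noLonger e) skip (setDist e)
  discover e = setDist e ⨾ (reached [ scalar row , scalar column ]≔ⁿ lit 1)
  relax    e = cond recorded (shorten e) (discover e)

  relaxEdge : Program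
  relaxEdge = cond (lit 1 ≤ⁿ adjacency [ scalar row , scalar column ])
    (relax (edge [ scalar row , scalar column ])) skip

  -- Enters all edges, and the trivial walk at each vertex.  For the latter,
  -- the column counter is set to the row after its loop has ended.
  relaxRow relaxEdges : Program
  relaxRow   = for column relaxEdge ⨾ ((column [ lit 0 , lit 0 ]≔ⁿ scalar row) ⨾ relax zeroʷ)
  relaxEdges = for row relaxRow

  -- Relaxes the entry (row, column) by the way through the vertex middle, if
  -- both legs have an entry.
  combine secondLeg relaxVia : Program
  combine   = relax (dist [ scalar row , scalar middle ] ⊕ dist [ scalar middle , scalar column ])
  secondLeg = cond (lit 1 ≤ⁿ reached [ scalar middle , scalar column ]) combine skip
  relaxVia  = cond (lit 1 ≤ⁿ reached [ scalar row , scalar middle ]) secondLeg skip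

  floydWarshall : Program
  floydWarshall = for middle (for row (for column relaxVia))

  -- The table with flags r and values w has an entry at (i,j), of value at most x.
  record Recorded (r : ℕ → ℕ → ℕ) (w : ℕ → ℕ → Carrier) (i j : ℕ) (x : Carrier) : Set ℓ₂ where
    constructor _,_
    field
      isReached : 1 ℕ.≤ r i j
      isWithin  : w i j ≤ x

  At : ∀ {n} → Config n → ℕ → ℕ → Carrier → Set ℓ₂
  At s = Recorded (nats s reached) (weights s dist)

  -- The table of s′ is that of s with one more value v entered at (i,j), in terms
  -- of the relation At.
  record Relaxed {n} (s s′ : Config n) (i j : ℕ) (v : Carrier) : Set (c ⊔ ℓ₂) where
    field
      keeps : ∀ {a b x} → At s a b x → At s′ a b x
      gains : At s′ i j v
      only  : ∀ {a b x} → At s′ a b x → At s a b x ⊎ (i ≡ a × j ≡ b × v ≤ x)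
  open Relaxed

  ≤ᵇ-true : ∀ {a b} → (a ≤ᵇ b) ≡ true → a ℕ.≤ b
  ≤ᵇ-true {a} {b} eq = ℕ.≤ᵇ⇒≤ a b (≡.subst T (≡.sym eq) tt)

  ≤ᵇ-false : ∀ {a b} → (a ≤ᵇ b) ≡ false → b ℕ.< a
  ≤ᵇ-false {a} {b} eq = ℕ.≰⇒> λ a≤b → ≡.subst T eq (ℕ.≤⇒≤ᵇ a≤b)

  ⌊⌋-true : ∀ {p} {P : Set p} (P? : Dec P) → ⌊ P? ⌋ ≡ true → P
  ⌊⌋-true (yes p) _ = p

  ⌊⌋-false : ∀ {p} {P : Set p} (P? : Dec P) → ⌊ P? ⌋ ≡ false → ¬ P
  ⌊⌋-false (no ¬p) _ = ¬p

  module _ {n} (O : Responder n) where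

    -- The two equations say that the value of e does not depend on the running time,
    -- which for a concrete e holds by computation.
    relax-spec : ∀ e s {v} → evalʷ O e (tick O s) ≡ v → evalʷ O e (tick O (tick O s)) ≡ v →
      Relaxed s (exec O (relax e) s) (nats s row 0 0) (nats s column 0 0) v
    relax-spec e s {v} eq₁ eq₂ = cond-rule O recorded (shorten e) (discover e) s (λ s′ → Relaxed s s′ i j v)
      (λ isReached → cond-rule O (noLonger e) skip (setDist e) (tick O s) (λ s′ → Relaxed s s′ i j v)
        (λ le → record
          { keeps = λ at → at
          ; gains = ≤ᵇ-true isReached , ≡.subst (weights s dist i j ≤_) eq₁ (⌊⌋-true (_ ≤? _) le)
          ; only  = inj₁ })
        (λ gt → shortened (≤ᵇ-true isReached)
          (≰⇒≥ (λ le → ⌊⌋-false (_ ≤? _) gt (≡.subst (weights s dist i j ≤_) (≡.sym eq₁) le))) eq₂))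
      (λ unreached → discovered (≤ᵇ-false unreached) eq₁)
      where
      i = nats s row 0 0
      j = nats s column 0 0

      shortened : ∀ {v′} → 1 ℕ.≤ nats s reached i j → v ≤ weights s dist i j → v′ ≡ v →
        Relaxed s (tick O (storeʷ O dist i j v′ (tick O (tick O s)))) i j v
      shortened r v≤ refl = record
        { keeps = λ {a} {b} (r , le) → r , kept (store-cases dist i j v (weights s) a b) le
        ; gains = r , ≤-reflexive (reflexive (store-same dist i j v (weights s)))
        ; only  = λ {a} {b} (r , le) →
            [ (λ (i≡ , j≡ , eq) → inj₂ (i≡ , j≡ , ≡.subst (_≤ _) eq le))
            , (λ eq → inj₁ (r , ≡.subst (_≤ _) eq le)) ]′ (store-cases dist i j v (weights s) a b)
        }
        where
        kept : ∀ {a b x} {stored : Carrier} →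
          (i ≡ a × j ≡ b × stored ≡ v) ⊎ stored ≡ weights s dist a b →
          weights s dist a b ≤ x → stored ≤ x
        kept (inj₁ (refl , refl , refl)) le = ≤-trans v≤ le
        kept (inj₂ refl)                 le = le

      discovered : ∀ {v′} → nats s reached i j ℕ.< 1 → v′ ≡ v →
        Relaxed s (tick O (storeⁿ O reached i j 1 (tick O (storeʷ O dist i j v′ (tick O s))))) i j v
      discovered un refl = record
        { keeps = λ {a} {b} (r , le) → kept a b r le
        ; gains = ℕ.≤-reflexive (≡.sym (store-same reached i j 1 (nats s)))
                , ≤-reflexive (reflexive (store-same dist i j v (weights s)))
        ; only  = λ {a} {b} (r , le) → only′ a b r le
        }
        where
        kept : ∀ a b {x} → 1 ℕ.≤ nats s reached a b → weights s dist a b ≤ x →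
          Recorded (store reached i j 1 (nats s) reached) (store dist i j v (weights s) dist) a b x
        kept a b r le with store-cases reached i j 1 (nats s) a b | store-cases dist i j v (weights s) a b
        ... | inj₁ (refl , refl , _) | _ = contradiction r (ℕ.<⇒≱ un)
        ... | inj₂ _ | inj₁ (refl , refl , _) = contradiction r (ℕ.<⇒≱ un)
        ... | inj₂ eq | inj₂ eq′ = ≡.subst (1 ℕ.≤_) (≡.sym eq) r , ≡.subst (_≤ _) (≡.sym eq′) le
        only′ : ∀ a b {x} → 1 ℕ.≤ store reached i j 1 (nats s) reached a b →
          store dist i j v (weights s) dist a b ≤ x → At s a b x ⊎ (i ≡ a × j ≡ b × v ≤ x)
        only′ a b r le with store-cases reached i j 1 (nats s) a b | store-cases dist i j v (weights s) a b
        ... | _ | inj₁ (i≡ , j≡ , eq) = inj₂ (i≡ , j≡ , ≡.subst (_≤ _) eq le)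
        ... | inj₁ (refl , refl , _) | inj₂ _ =
          inj₂ (refl , refl , ≡.subst (_≤ _) (store-same dist i j v (weights s)) le)
        ... | inj₂ eq | inj₂ eq′ = inj₁ (≡.subst (1 ℕ.≤_) eq r , ≡.subst (_≤ _) eq′ le)

  module FloydWarshall {n} (G : Graph n) (O : Responder n) where
    open Graph G
    open Distance G

    -- The configuration still holds the input graph.
    record Loaded (s : Config n) : Set (c ⊔ ℓ₁) where
      field
        size≡ : nats s 0 0 0 ≡ n
        adj≡  : ∀ u v → (1 ≤ᵇ nats s adjacency (toℕ u) (toℕ v)) ≡ ⌊ adj? u v ⌋
        edge≈ : ∀ {u v} → Adj u v → weights s edge (toℕ u) (toℕ v) ≈ weight u v
    open Loaded

    loaded-frame : ∀ {p s s′} → Frame p s s′ →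
      writesⁿ p 0 ≡ false → writesⁿ p adjacency ≡ false → writesʷ p edge ≡ false →
      Loaded s → Loaded s′
    loaded-frame f w₀ w₁ w₂ l = record
      { size≡ = ≡.trans (nats≡ f 0 w₀ 0 0) (size≡ l)
      ; adj≡  = λ u v → ≡.trans (≡.cong (1 ≤ᵇ_) (nats≡ f adjacency w₁ (toℕ u) (toℕ v))) (adj≡ l u v)
      ; edge≈ = λ {u} {v} e → ≈-trans (reflexive (weights≡ f edge w₂ (toℕ u) (toℕ v))) (edge≈ l e)
      }

    -- A relation W between two vertices and a weight x, read as: the distance is
    -- known to be at most x.
    Bound : Set (c ⊔ Level.suc ℓ₂)
    Bound = Fin n → Fin n → Carrier → Set ℓ₂

    -- W is closed under increasing the weight.
    Upward : Bound → Set (c ⊔ ℓ₂)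
    Upward W = ∀ {u v x y} → x ≤ y → W u v x → W u v y

    -- W bounds distances only from above.
    Sound : Bound → Set (c ⊔ ℓ₂)
    Sound W = ∀ {u v x} → W u v x → d u v ≤ x

    _⊑_ : Bound → Bound → Set (c ⊔ ℓ₂)
    W ⊑ W′ = ∀ {u v x} → W u v x → W′ u v x

    -- W knows the trivial walk at u and the edges from u.
    record Based (W : Bound) (u : Fin n) : Set (c ⊔ ℓ₂) where
      field
        stay : W u u 0#
        go   : ∀ v → Adj u v → W u v (weight u v)
    open Based

    -- The triangle inequality through each of the first k vertices.
    Triangle : ℕ → Bound → Set (c ⊔ ℓ₂)
    Triangle k W = ∀ {u m v x y} → toℕ m ℕ.< k → W u m x → W m v y → W u v (x + y)

    -- Phase k of the algorithm starts from the relation W.  Entries are overwritten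
    -- in place, so a leg may be read before or after its own relaxation; this is
    -- harmless because all entries stay within Via, and legs that end or start at
    -- k itself gain nothing from Via.
    module Phase (W : Bound) (up : Upward W) (sound : Sound W) (k : Fin n) where

      -- What W shows, directly or by a way through k.
      Via : Fin n → Fin n → Carrier → Set (c ⊔ ℓ₂)
      Via u v x = W u v x ⊎ ∃₂ λ y z → W u k y × W k v z × y + z ≤ x

      0≤W : ∀ {u v x} → W u v x → 0# ≤ x
      0≤W {u} {v} w = ≤-trans (0≤d u v) (sound w)

      via-sound : ∀ {u v x} → Via u v x → d u v ≤ x
      via-sound (inj₁ w) = sound w
      via-sound {u} {v} (inj₂ (y , z , a , b , le)) =
        ≤-trans (d-triangle u k v) (≤-trans (+-mono-≤ (sound a) (sound b)) le)

      via-into : ∀ {u x} → Via u k x → W u k x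
      via-into (inj₁ w) = w
      via-into (inj₂ (y , z , a , b , le)) = up (≤-trans (x≤x+y (0≤W b)) le) a

      via-from : ∀ {v x} → Via k v x → W k v x
      via-from (inj₁ w) = w
      via-from (inj₂ (y , z , a , b , le)) = up (≤-trans (x≤y+x (0≤W a)) le) b

      -- The way through k has been taken into account at (u,v).
      Treated : Bound → Fin n → Fin n → Set (c ⊔ ℓ₂)
      Treated W′ u v = ∀ {y z} → W u k y → W k v z → W′ u v (y + z)

      -- The relation W′ after phase k satisfies one more triangle inequality.  For
      -- an m before k, each of the two sides may be old or go through k; legs between
      -- m and k are dropped or joined by the triangle inequality of W.
      triangle-suc : ∀ W′ → Upward W′ → W ⊑ W′ → (∀ {u v x} → W′ u v x → Via u v x) →
                     (∀ u v → Treated W′ u v) →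
                     Triangle (toℕ k) W → Triangle (suc (toℕ k)) W′
      triangle-suc W′ up′ grows only treated tri {u} {m} {v} {x} {y} (ℕ.s≤s m≤k) um mv
        with m Fin.≟ k
      ... | yes refl = treated u v (via-into (only um)) (via-from (only mv))
      ... | no  m≢k  = split (only um) (only mv)
        where
        m<k : toℕ m ℕ.< toℕ k
        m<k = ℕ.≤∧≢⇒< m≤k (m≢k ∘ Fin.toℕ-injective)
        split : Via u m x → Via m v y → W′ u v (x + y)
        split (inj₁ um) (inj₁ mv) = grows (tri m<k um mv)
        split (inj₁ um) (inj₂ (a , b , mk , kv , a+b≤y)) =
          up′ (≤-respˡ-≈ (≈-sym (+-assoc x a b)) (+-monoʳ-≤ x a+b≤y))
            (treated u v (tri m<k um mk) kv)
        split (inj₂ (a , b , uk , km , a+b≤x)) (inj₁ mv) =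
          up′ (≤-respˡ-≈ (+-assoc a b y) (+-monoˡ-≤ y a+b≤x))
            (treated u v uk (tri m<k km mv))
        split (inj₂ (a , b , uk , km , a+b≤x)) (inj₂ (a′ , b′ , mk , kv , a′+b′≤y)) =
          up′ (+-mono-≤ (≤-trans (x≤x+y (0≤W km)) a+b≤x) (≤-trans (x≤y+x (0≤W mk)) a′+b′≤y))
            (treated u v uk kv)

    -- Induction on the walk, splitting off one edge at a time.
    triangle-walk : ∀ W → (∀ u → Based W u) → Triangle n W → ∀ {u v} (p : Walk u v) → W u v (len p)
    triangle-walk W based tri {u} [·] = stay (based u)
    triangle-walk W based tri {u} (_◅_ {j = m} e p) =
      tri (Fin.toℕ<n m) (go (based u) m e) (triangle-walk W based tri p)

    -- The relation held in the table of a configuration.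
    Table : Config n → Bound
    Table s u v = At s (toℕ u) (toℕ v)

    table-up : ∀ s → Upward (Table s)
    table-up s x≤y (r , le) = r , ≤-trans le x≤y

    -- The values in the table are the distances.
    Measured : Config n → Set ℓ₁
    Measured s = ∀ u v → weights s dist (toℕ u) (toℕ v) ≈ d u v

    measured : ∀ s → Sound (Table s) → (∀ u → Based (Table s) u) → Triangle n (Table s) → Measured s
    measured s sound based tri u v with triangle-walk (Table s) based tri (proj₁ (shortest u v))
    ... | r , le = antisym le (sound (r , ≤-refl))

    relaxed-only : ∀ {s s′} {u v : Fin n} {w} → Relaxed s s′ (toℕ u) (toℕ v) w →
      ∀ {a b x} → Table s′ a b x → Table s a b x ⊎ (u ≡ a × v ≡ b × w ≤ x)
    relaxed-only r at with only r at
    ... | inj₁ old = inj₁ old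
    ... | inj₂ (eq₁ , eq₂ , w≤x) = inj₂ (Fin.toℕ-injective eq₁ , Fin.toℕ-injective eq₂ , w≤x)

    relaxed-sound : ∀ {s s′} {u v : Fin n} {w} → Relaxed s s′ (toℕ u) (toℕ v) w →
                    d u v ≤ w → Sound (Table s) → Sound (Table s′)
    relaxed-sound r d≤w sound at with relaxed-only r at
    ... | inj₁ old = sound old
    ... | inj₂ (refl , refl , w≤x) = ≤-trans d≤w w≤x

    -- The effect of relaxVia on the relation held in the table.
    record Combined (W W′ : Bound) (k u v : Fin n) : Set (c ⊔ ℓ₂) where
      field
        grows : W ⊑ W′
        treat : ∀ {y z} → W u k y → W k v z → W′ u v (y + z)
        new   : ∀ {a b x} → W′ a b x → W a b x ⊎ (u ≡ a × v ≡ b ×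
                  ∃₂ λ y z → W u k y × W k v z × y + z ≤ x)
    open Combined

    relaxVia-spec : ∀ s {k u v : Fin n} → nats s middle 0 0 ≡ toℕ k → nats s row 0 0 ≡ toℕ u →
      nats s column 0 0 ≡ toℕ v → Combined (Table s) (Table (exec O relaxVia s)) k u v
    relaxVia-spec s {k} {u} {v} at-k at-u at-v =
      cond-rule O (lit 1 ≤ⁿ reached [ scalar row , scalar middle ]) secondLeg skip s
        (λ s′ → Combined (Table s) (Table s′) k u v)
        (λ uk → cond-rule O (lit 1 ≤ⁿ reached [ scalar middle , scalar column ]) combine skip (tick O s)
          (λ s′ → Combined (Table s) (Table s′) k u v)
          (λ kv → combined at-u at-v at-k (≤ᵇ-true uk) (≤ᵇ-true kv)
            (relax-spec O (dist [ scalar row , scalar middle ] ⊕ dist [ scalar middle , scalar column ])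
              (tick O (tick O s)) refl refl))
          (λ kv → unchanged λ { _ (r , _) → ℕ.<⇒≱ (≤ᵇ-false kv)
            (≡.subst₂ (λ k v → 1 ℕ.≤ nats s reached k v) (≡.sym at-k) (≡.sym at-v) r) }))
        (λ uk → unchanged λ { (r , _) _ → ℕ.<⇒≱ (≤ᵇ-false uk)
          (≡.subst₂ (λ u k → 1 ℕ.≤ nats s reached u k) (≡.sym at-u) (≡.sym at-k) r) })
      where
      unchanged : (∀ {y z} → Table s u k y → ¬ Table s k v z) → Combined (Table s) (Table s) k u v
      unchanged ¬legs = record
        { grows = λ w → w ; treat = λ a b → contradiction b (¬legs a) ; new = inj₁ }
      combined : ∀ {i j m s′} → i ≡ toℕ u → j ≡ toℕ v → m ≡ toℕ k →
        1 ℕ.≤ nats s reached i m → 1 ℕ.≤ nats s reached m j →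
        Relaxed (tick O (tick O s)) s′ i j (weights s dist i m + weights s dist m j) →
        Combined (Table s) (Table s′) k u v
      combined {s′ = s′} refl refl refl uk kv r = record
        { grows = keeps r
        ; treat = λ { (_ , uk≤) (_ , kv≤) → table-up s′ (+-mono-≤ uk≤ kv≤) (gains r) }
        ; new   = λ at → [ inj₁ , (λ (u≡ , v≡ , le) → inj₂ (u≡ , v≡ , _ , _ , (uk , ≤-refl) , (kv , ≤-refl) , le)) ]′
                    (relaxed-only r at)
        }

    relaxEdges-spec : ∀ s → Loaded s → Sound (Table s) →
      let s₁ = exec O relaxEdges s in Sound (Table s₁) × (∀ u → Based (Table s₁) u)
    relaxEdges-spec s loaded sound = result
      where
      relaxEdge-spec : ∀ s′ u v → Loaded s′ → nats s′ row 0 0 ≡ toℕ u → nats s′ column 0 0 ≡ toℕ v →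
        Sound (Table s′) → let s″ = exec O relaxEdge s′ in
        (Sound (Table s″) × Table s′ ⊑ Table s″) × (Adj u v → Table s″ u v (weight u v))
      relaxEdge-spec s′ u v loaded′ at-u at-v sound = cond-rule O
        (lit 1 ≤ⁿ adjacency [ scalar row , scalar column ]) (relax edgeHere) skip s′
        (λ s″ → (Sound (Table s″) × Table s′ ⊑ Table s″) × (Adj u v → Table s″ u v (weight u v)))
        (λ adj → adjacent at-u at-v (trans-adj adj) (relax-spec O edgeHere (tick O s′) refl refl))
        (λ ¬adj → (sound , λ w → w) , λ e → contradiction e (⌊⌋-false (adj? u v) (trans-adj ¬adj)))
        where
        edgeHere = edge [ scalar row , scalar column ]
        trans-adj : ∀ {b} → (1 ≤ᵇ nats s′ adjacency (nats s′ row 0 0) (nats s′ column 0 0)) ≡ b →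
                    ⌊ adj? u v ⌋ ≡ b
        trans-adj eq = ≡.trans (≡.sym (adj≡ loaded′ u v))
          (≡.trans (≡.cong₂ (λ i j → 1 ≤ᵇ nats s′ adjacency i j) (≡.sym at-u) (≡.sym at-v)) eq)
        adjacent : ∀ {i j s″} → i ≡ toℕ u → j ≡ toℕ v → ⌊ adj? u v ⌋ ≡ true →
          Relaxed (tick O s′) s″ i j (weights s′ edge i j) →
          (Sound (Table s″) × Table s′ ⊑ Table s″) × (Adj u v → Table s″ u v (weight u v))
        adjacent {s″ = s″} refl refl adj r =
          (relaxed-sound r (≤-trans (d≤weight e) (≤-reflexive (≈-sym (edge≈ loaded′ e)))) sound , keeps r)
          , λ _ → table-up s″ (≤-reflexive (edge≈ loaded′ e)) (gains r)
          where
          e = ⌊⌋-true (adj? u v) adj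

      row-spec : ∀ s′ u → Loaded s′ → nats s′ row 0 0 ≡ toℕ u → Sound (Table s′) →
        let s″ = exec O relaxRow s′ in
        (Sound (Table s″) × Table s′ ⊑ Table s″) × Based (Table s″) u
      row-spec s′ u loaded′ at-u sound with for-each O column relaxEdge s′ (size≡ loaded′)
          (λ s″ → Sound (Table s″) × Table s′ ⊑ Table s″)
          (λ v s″ → Adj u v → Table s″ u v (weight u v))
          (sound , λ w → w) (λ _ _ J → J) (λ _ _ _ J → J)
          (λ v s″ f at-v (sound , g) →
            let (sound′ , g′) , e = relaxEdge-spec s″ u v (loaded-frame f refl refl refl loaded′)
                                      (≡.trans (nats≡ f row refl 0 0) at-u) at-v sound
            in (sound′ , g′ ∘ g) , e , λ _ _ e′ a → g′ (e′ a))
      ... | (sound₁ , g₁) , edges = diagonal at-u′ (relax-spec O zeroʷ s₂ refl refl)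
        where
        s₁ = exec O (for column relaxEdge) s′
        s₂ = exec O (column [ lit 0 , lit 0 ]≔ⁿ scalar row) s₁
        at-u′ : nats s₁ row 0 0 ≡ toℕ u
        at-u′ = ≡.trans (nats≡ (frame O (for column relaxEdge) s′) row refl 0 0) at-u
        diagonal : ∀ {i s₃} → i ≡ toℕ u → Relaxed s₂ s₃ i i 0# →
          (Sound (Table s₃) × Table s′ ⊑ Table s₃) × Based (Table s₃) u
        diagonal refl r = (relaxed-sound r (d≤len [·]) sound₁ , keeps r ∘ g₁)
                        , record { stay = gains r ; go = λ v e → keeps r (edges v e) }

      result : Sound (Table (exec O relaxEdges s)) × (∀ u → Based (Table (exec O relaxEdges s)) u)
      result = for-each O row relaxRow s (size≡ loaded)
        (λ s′ → Sound (Table s′)) (λ u s′ → Based (Table s′) u)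
        sound (λ _ _ J → J) (λ _ _ _ J → record { stay = stay J ; go = go J })
        (λ u s′ f at-u sound →
          let (sound′ , g) , based = row-spec s′ u (loaded-frame f refl refl refl loaded) at-u sound
          in sound′ , based , λ _ _ b → record { stay = g (stay b) ; go = λ v e → g (go b v e) })

    floydWarshall-spec : ∀ s → nats s 0 0 0 ≡ n → Sound (Table s) → (∀ u → Based (Table s) u) →
                         Measured (exec O floydWarshall s)
    floydWarshall-spec s sz sound based with for-rule O middle (for row (for column relaxVia)) s sz
        (λ k s′ → Sound (Table s′) × Table s ⊑ Table s′ × Triangle k (Table s′))
        (sound , (λ w → w) , λ ())
        (λ _ _ J → J)
        phase
      where
      phase : ∀ k s₀ → Frame floydWarshall s s₀ → nats s₀ middle 0 0 ≡ toℕ k →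
        Sound (Table s₀) × Table s ⊑ Table s₀ × Triangle (toℕ k) (Table s₀) →
        let s₁ = exec O (for row (for column relaxVia)) s₀ in
        Sound (Table s₁) × Table s ⊑ Table s₁ × Triangle (suc (toℕ k)) (Table s₁)
      phase k s₀ f at-k (sound , grows₀ , tri) = result
        where
        open Phase (Table s₀) (table-up s₀) sound k
        s₁ = exec O (for row (for column relaxVia)) s₀

        -- The invariant of phase k.
        Within : Config n → Set (c ⊔ ℓ₂)
        Within s′ = Table s₀ ⊑ Table s′ × (∀ {u v x} → Table s′ u v x → Via u v x)

        step : ∀ s₂ u v → nats s₂ middle 0 0 ≡ toℕ k → nats s₂ row 0 0 ≡ toℕ u →
               nats s₂ column 0 0 ≡ toℕ v → Within s₂ →
               let s₃ = exec O relaxVia s₂ in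
               Within s₃ × Table s₂ ⊑ Table s₃ × Treated (Table s₃) u v
        step s₂ u v at-k at-u at-v (g , o) = (grows comb ∘ g , only′) , grows comb , λ a b → treat comb (g a) (g b)
          where
          comb = relaxVia-spec s₂ at-k at-u at-v
          only′ : ∀ {a b x} → Table (exec O relaxVia s₂) a b x → Via a b x
          only′ at with new comb at
          ... | inj₁ old = o old
          ... | inj₂ (refl , refl , y , z , a , b , le) = inj₂ (y , z , via-into (o a) , via-from (o b) , le)

        columns : ∀ u s₂ → nats s₂ 0 0 0 ≡ n → nats s₂ middle 0 0 ≡ toℕ k → nats s₂ row 0 0 ≡ toℕ u → Within s₂ →
          let s₃ = exec O (for column relaxVia) s₂ in
          (Within s₃ × Table s₂ ⊑ Table s₃) × (∀ v → Treated (Table s₃) u v)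
        columns u s₂ sz at-k at-u within = for-each O column relaxVia s₂ sz
            (λ s′ → Within s′ × Table s₂ ⊑ Table s′) (λ v s′ → Treated (Table s′) u v)
            (within , λ w → w) (λ _ _ J → J) (λ _ _ _ J → J)
            (λ v s′ f at-v (w , g) →
              let w′ , g′ , t = step s′ u v (≡.trans (nats≡ f middle refl 0 0) at-k)
                                  (≡.trans (nats≡ f row refl 0 0) at-u) at-v w
              in (w′ , g′ ∘ g) , t , λ _ _ t′ a b → g′ (t′ a b))

        rows : Within s₁ × (∀ u v → Treated (Table s₁) u v)
        rows = for-each O row (for column relaxVia) s₀ (≡.trans (nats≡ f 0 refl 0 0) sz)
            Within (λ u s′ → ∀ v → Treated (Table s′) u v)
            ((λ w → w) , inj₁) (λ _ _ J → J) (λ _ _ _ J → J)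
            (λ u s′ f′ at-u w →
              let (w′ , g) , t = columns u s′
                    (≡.trans (nats≡ f′ 0 refl 0 0) (≡.trans (nats≡ f 0 refl 0 0) sz))
                    (≡.trans (nats≡ f′ middle refl 0 0) at-k) at-u w
              in w′ , t , λ _ _ t′ v a b → g (t′ v a b))

        result : Sound (Table s₁) × Table s ⊑ Table s₁ × Triangle (suc (toℕ k)) (Table s₁)
        result = let (g , o) , t = rows in
          via-sound ∘ o , g ∘ grows₀ , triangle-suc (Table s₁) (table-up s₁) g o t tri
    ... | sound , grows , tri = measured (exec O floydWarshall s) sound (λ u → record
      { stay = grows (stay (based u)) ; go = λ v e → grows (go (based u) v e) }) tri

-- The program for median search

module Rounds {c ℓ₁ ℓ₂} (R : RealField c ℓ₁ ℓ₂) where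
  open RealField R renaming (refl to ≈-refl; sym to ≈-sym; trans to ≈-trans)
  open DirectionSearch R
  open Machine R
  open Search R
  open Paths R

  -- The result, the indicator of the candidates' set in the cells [ x , 0 ], and
  -- scalars: three loop counters (element, neighbour, vertex), the numbers
  -- computed in a round, and the counter of the rounds.
  result candidate element neighbour vertex count potential best chosen response towards round : Array
  result    = 2
  candidate = 7
  element   = 8
  neighbour = 9
  vertex    = 10
  count     = 11
  potential = 12
  best      = 13
  chosen    = 14
  response  = 15
  towards   = 16
  round     = 17

  infix 6 _:=_
  _:=_ : Array → NatExp → Program
  a := e = a [ lit 0 , lit 0 ]≔ⁿ e

  setCandidate : NatExp → ℕ → Program
  setCandidate e k = candidate [ e , lit 0 ]≔ⁿ lit k

  isCandidate : Test
  isCandidate = lit 1 ≤ⁿ candidate [ scalar element , lit 0 ]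

  -- The element lies in N(v,u), for an edge vu.  As d v x ≤ weight v u + d u x
  -- holds anyway, the converse inequality decides the equation.
  onWay : Array → Array → Test
  onWay v u = edge [ scalar v , scalar u ] ⊕ dist [ scalar u , scalar element ]
              ≤ʷ dist [ scalar v , scalar element ]

  bump : Program
  bump = count := lit 1 ⊕ scalar count

  -- Counts the elements at which p bumps the counter.
  countWith : Program → Program
  countWith p = (count := lit 0) ⨾ for element p

  tally tallyOnWay tallyToward : Program
  tally       = cond isCandidate bump skip
  tallyOnWay  = cond (onWay vertex neighbour) bump skip
  tallyToward = cond isCandidate tallyOnWay skip

  -- computeΓ leaves Γ at the current vertex in the scalar potential.
  raise towardNeighbour tryNeighbour computeΓ : Program
  raise           = cond (scalar potential ≤ⁿ scalar count) (potential := scalar count) skip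
  towardNeighbour = countWith tallyToward ⨾ raise
  tryNeighbour    = cond (lit 1 ≤ⁿ adjacency [ scalar vertex , scalar neighbour ]) towardNeighbour skip
  computeΓ        = (potential := lit 0) ⨾ for neighbour tryNeighbour

  -- findMedian leaves a minimiser of Γ in the scalar chosen.  Starting from the
  -- value n is safe: no potential exceeds n, and ties replace the choice, so the
  -- first vertex is chosen at once.
  choose improve tryVertex findMedian : Program
  choose     = (best := scalar potential) ⨾ (chosen := scalar vertex)
  improve    = cond (scalar potential ≤ⁿ scalar best) choose skip
  tryVertex  = computeΓ ⨾ improve
  findMedian = (best := scalar 0) ⨾ for vertex tryVertex

  -- Sets all cells of the indicator of the candidates' set.
  fill : ℕ → Program
  fill k = for element (setCandidate (scalar element) k)

  -- The candidates' set after a response.  It becomes the queried vertex alone if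
  -- the target was found.  Otherwise the response is 1 + u, and u is recovered as
  -- the last neighbour counter with 1 + neighbour ≤ response.
  keepChosen decodeStep decode narrowStep narrow respond : Program
  keepChosen = fill 0 ⨾ setCandidate (scalar chosen) 1
  decodeStep = cond (lit 1 ⊕ scalar neighbour ≤ⁿ scalar response) (towards := scalar neighbour) skip
  decode     = for neighbour decodeStep
  narrowStep = cond (onWay chosen towards) skip (setCandidate (scalar element) 0)
  narrow     = decode ⨾ for element narrowStep
  respond    = cond (scalar response ≤ⁿ lit 0) keepChosen narrow

  -- The rounds after the candidates are down to one do nothing but count, and
  -- report then stores this candidate.
  searchStep searchRound report main : Program
  searchStep  = findMedian ⨾ (query (scalar chosen) response ⨾ respond)
  searchRound = countWith tally ⨾ cond (lit 2 ≤ⁿ scalar count) searchStep skip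
  report      = for element (cond isCandidate (result := scalar element) skip)
  main        = fill 1 ⨾ (relaxEdges ⨾ (floydWarshall ⨾ (for round searchRound ⨾ report)))

  bit : Bool → ℕ
  bit b = if b then 1 else 0

  -- The number of i < k with P i.  It grows at the upper end, in step with a loop,
  -- and is defined by recursion from the lower end, as subsets are.
  prefix : ∀ {n} → (Fin n → Bool) → ℕ → ℕ
  prefix {n}     P zero    = 0
  prefix {zero}  P (suc k) = 0
  prefix {suc n} P (suc k) = bit (P Fin.zero) ℕ.+ prefix (P ∘ Fin.suc) k

  prefix-suc : ∀ {n} (P : Fin n → Bool) i → prefix P (suc (toℕ i)) ≡ bit (P i) ℕ.+ prefix P (toℕ i)
  prefix-suc P Fin.zero = refl
  prefix-suc P (Fin.suc i) =
    ≡.trans (≡.cong (bit (P Fin.zero) ℕ.+_) (prefix-suc (P ∘ Fin.suc) i))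
            (x∙yz≈y∙xz (bit (P Fin.zero)) (bit (P (Fin.suc i))) _)
    where open import Algebra.Properties.CommutativeSemigroup ℕ.+-commutativeSemigroup using (x∙yz≈y∙xz)

  prefix-all : ∀ {n} (S : Subset n) P → (∀ x → lookup S x ≡ P x) → prefix P n ≡ ∣ S ∣
  prefix-all []      P eq = refl
  prefix-all (b ∷ S) P eq with P Fin.zero | eq Fin.zero
  ... | true  | refl = ≡.cong suc (prefix-all S (P ∘ Fin.suc) (eq ∘ Fin.suc))
  ... | false | refl = prefix-all S (P ∘ Fin.suc) (eq ∘ Fin.suc)

  ⌊⌋-cong : ∀ {p q} {P : Set p} {Q : Set q} (P? : Dec P) (Q? : Dec Q) →
            (P → Q) → (Q → P) → ⌊ P? ⌋ ≡ ⌊ Q? ⌋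
  ⌊⌋-cong (yes p) (yes q) f g = refl
  ⌊⌋-cong (yes p) (no ¬q) f g = contradiction (f p) ¬q
  ⌊⌋-cong (no ¬p) (yes q) f g = contradiction (g q) ¬p
  ⌊⌋-cong (no ¬p) (no ¬q) f g = refl

  module Median {n} (G : Graph n) (O : Responder n) where
    open Graph G
    open Distance G
    open FloydWarshall G O
    open Loaded

    -- The input is in place and the distances have been computed.
    record Ready (s : Config n) : Set (c ⊔ ℓ₁) where
      constructor _,_
      field
        loaded   : Loaded s
        dist≈    : Measured s
    open Ready

    ready-frame : ∀ {p s s′} → Frame p s s′ →
      writesⁿ p 0 ≡ false → writesⁿ p adjacency ≡ false →
      writesʷ p edge ≡ false → writesʷ p dist ≡ false →
      Ready s → Ready s′
    ready-frame f w₀ w₁ w₂ w₃ (l , m) = loaded-frame f w₀ w₁ w₂ l ,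
      λ u v → ≈-trans (reflexive (weights≡ f dist w₃ (toℕ u) (toℕ v))) (m u v)

    -- The indicator in the configuration is that of the set S.
    Holds : Config n → Subset n → Set
    Holds s S = ∀ x → (1 ≤ᵇ nats s candidate (toℕ x) 0) ≡ lookup S x

    holds-frame : ∀ {p s s′ S} → Frame p s s′ → writesⁿ p candidate ≡ false → Holds s S → Holds s′ S
    holds-frame f w h x = ≡.trans (≡.cong (1 ≤ᵇ_) (nats≡ f candidate w (toℕ x) 0)) (h x)

    isCandidate-test : ∀ s S x → Holds s S → nats s element 0 0 ≡ toℕ x → test O isCandidate s ≡ lookup S x
    isCandidate-test s S x h at-x = ≡.trans (≡.cong (λ i → 1 ≤ᵇ nats s candidate i 0) at-x) (h x)

    onWay-test : ∀ s a b {v u x} → Ready s → Adj v u →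
      nats s a 0 0 ≡ toℕ v → nats s b 0 0 ≡ toℕ u → nats s element 0 0 ≡ toℕ x →
      test O (onWay a b) s ≡ lookup (N v u) x
    onWay-test s a b {v} {u} {x} ready e at-v at-u at-x =
      ≡.trans (at at-v at-u at-x) (≡.sym (lookup-N v u x))
      where
      sum≈ : weights s edge (toℕ v) (toℕ u) + weights s dist (toℕ u) (toℕ x) ≈ weight v u + d u x
      sum≈ = +-cong (edge≈ (loaded ready) e) (dist≈ ready u x)
      at : ∀ {i j k} → i ≡ toℕ v → j ≡ toℕ u → k ≡ toℕ x →
        ⌊ weights s edge i j + weights s dist j k ≤? weights s dist i k ⌋ ≡ ⌊ d v x ≟ weight v u + d u x ⌋
      at refl refl refl = ⌊⌋-cong (_ ≤? _) (_ ≟ _)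
        (λ le → antisym (d≤weight+d e x) (≤-respˡ-≈ sum≈ (≤-respʳ-≈ (dist≈ ready v x) le)))
        (λ eq → ≤-respˡ-≈ (≈-sym sum≈) (≤-respʳ-≈ (≈-sym (dist≈ ready v x)) (≤-reflexive (≈-sym eq))))

    count-spec : ∀ p s P → nats s 0 0 0 ≡ n →
      (∀ x s′ → Frame (countWith p) s s′ → nats s′ element 0 0 ≡ toℕ x →
       nats (exec O p s′) count 0 0 ≡ bit (P x) ℕ.+ nats s′ count 0 0) →
      nats (exec O (countWith p) s) count 0 0 ≡ prefix P n
    count-spec p s P size step = for-rule O element p s₀ size
      (λ k s′ → nats s′ count 0 0 ≡ prefix P k) refl (λ _ _ J → J)
      (λ x s′ f at-x J → ≡.trans (step x s′ (frame-⨾ O (frame O (count := lit 0) s) f) at-x)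
        (≡.trans (≡.cong (bit (P x) ℕ.+_) J) (≡.sym (prefix-suc P x))))
      where
      s₀ = exec O (count := lit 0) s

    tally-spec : ∀ s S → nats s 0 0 0 ≡ n → Holds s S → nats (exec O (countWith tally) s) count 0 0 ≡ ∣ S ∣
    tally-spec s S size h = ≡.trans
      (count-spec tally s (lookup S) size λ x s′ f at-x →
        let inS = isCandidate-test s′ S x (holds-frame {S = S} f refl h) at-x in
        cond-rule O isCandidate bump skip s′ (λ s″ → nats s″ count 0 0 ≡ bit (lookup S x) ℕ.+ nats s′ count 0 0)
          (λ eq → ≡.cong (λ b → bit b ℕ.+ nats s′ count 0 0) (≡.trans (≡.sym eq) inS))
          (λ eq → ≡.cong (λ b → bit b ℕ.+ nats s′ count 0 0) (≡.trans (≡.sym eq) inS)))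
      (prefix-all S _ λ _ → refl)

    tallyToward-spec : ∀ s S {v u} → Ready s → Holds s S → Adj v u →
      nats s vertex 0 0 ≡ toℕ v → nats s neighbour 0 0 ≡ toℕ u →
      nats (exec O (countWith tallyToward) s) count 0 0 ≡ ∣ N v u ∩ S ∣
    tallyToward-spec s S {v} {u} ready h e at-v at-u = ≡.trans
      (count-spec tallyToward s (λ x → lookup S x ∧ lookup (N v u) x) (size≡ (loaded ready)) λ x s′ f at-x →
        let Goal : Bool → Config n → Set
            Goal b s″ = nats s″ count 0 0 ≡ bit b ℕ.+ nats s′ count 0 0
            inS = isCandidate-test s′ S x (holds-frame {S = S} f refl h) at-x
            inN = onWay-test s′ vertex neighbour (ready-frame f refl refl refl refl ready) e
                    (≡.trans (nats≡ f vertex refl 0 0) at-v) (≡.trans (nats≡ f neighbour refl 0 0) at-u) at-x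
        in cond-rule O isCandidate tallyOnWay skip s′ (Goal (lookup S x ∧ lookup (N v u) x))
          (λ eq → cond-rule O (onWay vertex neighbour) bump skip (tick O s′) (Goal (lookup S x ∧ lookup (N v u) x))
            (λ eq′ → ≡.cong₂ (λ b b′ → bit (b ∧ b′) ℕ.+ nats s′ count 0 0) (≡.trans (≡.sym eq) inS) (≡.trans (≡.sym eq′) inN))
            (λ eq′ → ≡.cong₂ (λ b b′ → bit (b ∧ b′) ℕ.+ nats s′ count 0 0) (≡.trans (≡.sym eq) inS) (≡.trans (≡.sym eq′) inN)))
          (λ eq → ≡.cong (λ b → bit (b ∧ lookup (N v u) x) ℕ.+ nats s′ count 0 0) (≡.trans (≡.sym eq) inS)))
      (prefix-all (N v u ∩ S) _ λ x → ≡.trans (Vec.lookup-zipWith _∧_ x (N v u) S) (Bool.∧-comm (lookup (N v u) x) (lookup S x)))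

    computeΓ-spec : ∀ s S v → Ready s → Holds s S → nats s vertex 0 0 ≡ toℕ v →
      nats (exec O computeΓ s) potential 0 0 ≡ Γ S v
    computeΓ-spec s S v ready h at-v = conclude (exec O computeΓ s)
      (for-each O neighbour tryNeighbour s₀ (size≡ (loaded ready)) Least Above
        (λ _ _ → ℕ.z≤n) (λ _ _ J → J) (λ _ _ _ J → J)
        (λ u s′ f at-u least → let f′ = frame-⨾ O (frame O (potential := lit 0) s) f in
          step u s′ (ready-frame f′ refl refl refl refl ready) (holds-frame {S = S} f′ refl h)
            (≡.trans (nats≡ f′ vertex refl 0 0) at-v) at-u least))
      where
      s₀ = exec O (potential := lit 0) s

      -- The scalar potential is a lower bound of the upper bounds.
      Least : Config n → Set
      Least s′ = ∀ b → (∀ {u} → Adj v u → ∣ N v u ∩ S ∣ ℕ.≤ b) → nats s′ potential 0 0 ℕ.≤ b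

      Above : Fin n → Config n → Set
      Above u s′ = Adj v u → ∣ N v u ∩ S ∣ ℕ.≤ nats s′ potential 0 0

      conclude : ∀ s′ → Least s′ × (∀ u → Above u s′) → nats s′ potential 0 0 ≡ Γ S v
      conclude s′ (least , above) = ℕ.≤-antisym (least (Γ S v) (∣N∩∣≤Γ S)) (Γ≤ S v (λ {u} → above u))

      Step : Fin n → Config n → Config n → Set
      Step u s′ s″ = Least s″ × Above u s″ × (∀ j → j ≢ u → Above j s′ → Above j s″)

      step : ∀ u s′ → Ready s′ → Holds s′ S → nats s′ vertex 0 0 ≡ toℕ v → nats s′ neighbour 0 0 ≡ toℕ u →
        Least s′ → Step u s′ (exec O tryNeighbour s′)
      step u s′ ready h at-v at-u least = cond-rule O
        (lit 1 ≤ⁿ adjacency [ scalar vertex , scalar neighbour ]) towardNeighbour skip s′ (Step u s′)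
        (λ adj → raised (⌊⌋-true (adj? v u) (isAdj adj)))
        (λ ¬adj → least , (λ e → contradiction e (⌊⌋-false (adj? v u) (isAdj ¬adj))) , λ _ _ a → a)
        where
        isAdj : ∀ {b} → (1 ≤ᵇ nats s′ adjacency (nats s′ vertex 0 0) (nats s′ neighbour 0 0)) ≡ b →
                ⌊ adj? v u ⌋ ≡ b
        isAdj eq = ≡.trans (≡.sym (adj≡ (loaded ready) v u))
          (≡.trans (≡.cong₂ (λ i j → 1 ≤ᵇ nats s′ adjacency i j) (≡.sym at-v) (≡.sym at-u)) eq)
        raised : Adj v u → Step u s′ (exec O towardNeighbour (tick O s′))
        raised e = cond-rule O (scalar potential ≤ⁿ scalar count) (potential := scalar count) skip s₁ (Step u s′)
          (λ le → (λ b bound → ℕ.≤-trans (ℕ.≤-reflexive counted) (bound e))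
                , (λ _ → ℕ.≤-reflexive (≡.sym counted))
                , λ _ _ above e′ → ℕ.≤-trans (above e′) (ℕ.≤-trans (ℕ.≤-reflexive (≡.sym kept)) (≤ᵇ-true le)))
          (λ gt → (λ b bound → ℕ.≤-trans (ℕ.≤-reflexive kept) (least b bound))
                , (λ _ → ℕ.≤-trans (ℕ.≤-reflexive (≡.sym counted)) (ℕ.<⇒≤ (≤ᵇ-false gt)))
                , λ _ _ above e′ → ℕ.≤-trans (above e′) (ℕ.≤-reflexive (≡.sym kept)))
          where
          s₁ = exec O (countWith tallyToward) (tick O s′)
          counted : nats s₁ count 0 0 ≡ ∣ N v u ∩ S ∣
          counted = tallyToward-spec (tick O s′) S (ready-frame (frame O skip s′) refl refl refl refl ready) h e at-v at-u
          kept : nats s₁ potential 0 0 ≡ nats s′ potential 0 0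
          kept = nats≡ (frame O (countWith tallyToward) (tick O s′)) potential refl 0 0

    findMedian-spec : ∀ s S → Fin n → Ready s → Holds s S →
      ∃ λ v → nats (exec O findMedian s) chosen 0 0 ≡ toℕ v × (∀ y → Γ S v ℕ.≤ Γ S y)
    findMedian-spec s S v₀ ready h = conclude (exec O findMedian s)
      (for-each O vertex tryVertex s₀ (size≡ (loaded ready)) (λ s′ → nats s′ best 0 0 ≡ n ⊎ Valid s′)
        (λ v s′ → Valid s′ × nats s′ best 0 0 ℕ.≤ Γ S v)
        (inj₁ (size≡ (loaded ready))) (λ _ _ J → J) (λ _ _ _ J → J)
        (λ v s′ f at-v inv → let f′ = frame-⨾ O (frame O (best := scalar 0) s) f in
          step v s′ (ready-frame f′ refl refl refl refl ready) (holds-frame {S = S} f′ refl h) at-v inv))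
      where
      s₀ = exec O (best := scalar 0) s

      -- The scalars chosen and best belong to the same vertex.
      Valid : Config n → Set
      Valid s′ = ∃ λ v → nats s′ chosen 0 0 ≡ toℕ v × nats s′ best 0 0 ≡ Γ S v

      conclude : ∀ s′ → (nats s′ best 0 0 ≡ n ⊎ Valid s′) × (∀ v → Valid s′ × nats s′ best 0 0 ℕ.≤ Γ S v) →
        ∃ λ v → nats s′ chosen 0 0 ≡ toℕ v × (∀ y → Γ S v ℕ.≤ Γ S y)
      conclude s′ (_ , all) with proj₁ (all v₀)
      ... | v , at-v , best≡ = v , at-v , λ y → ℕ.≤-trans (ℕ.≤-reflexive (≡.sym best≡)) (proj₂ (all y))

      Γ≤n : ∀ v → Γ S v ℕ.≤ n
      Γ≤n v = Γ≤ S v λ {u} _ → Subset.∣p∣≤n (N v u ∩ S)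

      Step : Fin n → Config n → Config n → Set
      Step v s′ s″ = (nats s″ best 0 0 ≡ n ⊎ Valid s″) × (Valid s″ × nats s″ best 0 0 ℕ.≤ Γ S v) ×
        (∀ j → j ≢ v → Valid s′ × nats s′ best 0 0 ℕ.≤ Γ S j → Valid s″ × nats s″ best 0 0 ℕ.≤ Γ S j)

      step : ∀ v s′ → Ready s′ → Holds s′ S → nats s′ vertex 0 0 ≡ toℕ v →
        (nats s′ best 0 0 ≡ n ⊎ Valid s′) → Step v s′ (exec O tryVertex s′)
      step v s′ ready h at-v inv = cond-rule O (scalar potential ≤ⁿ scalar best) choose skip s₁ (Step v s′)
        (λ le → let valid = v , at-v₁ , computed in
            inj₂ valid , (valid , ℕ.≤-reflexive computed)
          , λ j _ (_ , old) → valid , ℕ.≤-trans (≤ᵇ-true le) (ℕ.≤-trans (ℕ.≤-reflexive kept) old))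
        (λ gt → let valid = keepValid (≤ᵇ-false gt) inv in
            inj₂ valid , (valid , ℕ.≤-trans (ℕ.<⇒≤ (≤ᵇ-false gt)) (ℕ.≤-reflexive computed))
          , λ j _ (_ , old) → valid , ℕ.≤-trans (ℕ.≤-reflexive kept) old)
        where
        s₁ = exec O computeΓ s′
        f = frame O computeΓ s′
        computed : nats s₁ potential 0 0 ≡ Γ S v
        computed = computeΓ-spec s′ S v ready h at-v
        kept : nats s₁ best 0 0 ≡ nats s′ best 0 0
        kept = nats≡ f best refl 0 0
        at-v₁ : nats s₁ vertex 0 0 ≡ toℕ v
        at-v₁ = ≡.trans (nats≡ f vertex refl 0 0) at-v
        keepValid : nats s₁ best 0 0 ℕ.< nats s₁ potential 0 0 → nats s′ best 0 0 ≡ n ⊎ Valid s′ → Valid s₁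
        keepValid gt (inj₁ best≡n) = contradiction
          (ℕ.≤-trans (ℕ.≤-reflexive computed) (ℕ.≤-trans (Γ≤n v) (ℕ.≤-reflexive (≡.sym (≡.trans kept best≡n)))))
          (ℕ.<⇒≱ gt)
        keepValid gt (inj₂ (b , at-b , best≡)) =
          b , ≡.trans (nats≡ f chosen refl 0 0) at-b , ≡.trans kept best≡

    fill-spec : ∀ k s → nats s 0 0 0 ≡ n → ∀ x → nats (exec O (fill k) s) candidate (toℕ x) 0 ≡ k
    fill-spec k s size = proj₂ (for-each O element (setCandidate (scalar element) k) s size (λ _ → Unit)
      (λ x s′ → nats s′ candidate (toℕ x) 0 ≡ k) tt (λ _ _ J → J) (λ _ _ _ J → J)
      (λ x s′ f at-x _ → tt , written x (nats s′) at-x , λ j _ → kept j (nats s′ element 0 0) (nats s′)))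
      where
      written : ∀ (x : Fin n) {i} m → i ≡ toℕ x → store candidate i 0 k m candidate (toℕ x) 0 ≡ k
      written x m refl = store-same candidate (toℕ x) 0 k m
      kept : ∀ (j : Fin n) i m → m candidate (toℕ j) 0 ≡ k → store candidate i 0 k m candidate (toℕ j) 0 ≡ k
      kept j i m old =
        [ (λ (_ , _ , eq) → eq) , (λ eq → ≡.trans eq old) ]′ (store-cases candidate i 0 k m (toℕ j) 0)

    fill-1-holds : ∀ s → nats s 0 0 0 ≡ n → Holds (exec O (fill 1) s) ⊤
    fill-1-holds s size x = ≡.trans (≡.cong (1 ≤ᵇ_) (fill-spec 1 s size x)) (≡.sym (Vec.lookup-replicate x true))

    keepChosen-spec : ∀ s v → nats s 0 0 0 ≡ n → nats s chosen 0 0 ≡ toℕ v →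
      Holds (exec O keepChosen s) ⁅ v ⁆
    keepChosen-spec s v size at-v x = at (≡.trans (nats≡ (frame O (fill 0) s) chosen refl 0 0) at-v)
      where
      s₁ = exec O (fill 0) s
      cleared : ∀ x → nats s₁ candidate (toℕ x) 0 ≡ 0
      cleared = fill-spec 0 s size
      at : ∀ {i} → i ≡ toℕ v → (1 ≤ᵇ store candidate i 0 1 (nats s₁) candidate (toℕ x) 0) ≡ lookup ⁅ v ⁆ x
      at refl with store-cases candidate (toℕ v) 0 1 (nats s₁) (toℕ x) 0
      ... | inj₁ (v≡x , _ , eq) = ≡.trans (≡.cong (1 ≤ᵇ_) eq)
        (≡.sym (≡.subst (λ y → lookup ⁅ v ⁆ y ≡ true) (Fin.toℕ-injective v≡x) (Vec.[]=⇒lookup (Subset.x∈⁅x⁆ v))))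
      ... | inj₂ eq with v Fin.≟ x
      ...   | yes refl = contradiction (≡.trans (≡.sym (store-same candidate (toℕ v) 0 1 (nats s₁))) (≡.trans eq (cleared v))) λ ()
      ...   | no v≢x = ≡.trans (≡.cong (1 ≤ᵇ_) (≡.trans eq (cleared x)))
        (≡.sym (Bool.¬-not λ x∈ → v≢x (≡.sym (Subset.x∈⁅y⁆⇒x≡y v (Vec.lookup⇒[]= x ⁅ v ⁆ x∈)))))

    decode-spec : ∀ s u → nats s 0 0 0 ≡ n → nats s response 0 0 ≡ suc (toℕ u) →
      nats (exec O decode s) towards 0 0 ≡ toℕ u
    decode-spec s u size at-r = for-rule O neighbour decodeStep s size
      (λ k s′ → toℕ u ℕ.< k → nats s′ towards 0 0 ≡ toℕ u) (λ ()) (λ _ _ J → J)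
      (λ i s′ f at-i J → let r≡ = ≡.trans (nats≡ f response refl 0 0) at-r in
        cond-rule O (lit 1 ⊕ scalar neighbour ≤ⁿ scalar response) (towards := scalar neighbour) skip s′
          (λ s″ → toℕ u ℕ.< suc (toℕ i) → nats s″ towards 0 0 ≡ toℕ u)
          (λ le u<1+i → ≡.trans at-i (ℕ.≤-antisym
            (ℕ.s≤s⁻¹ (≡.subst₂ (λ i r → suc i ℕ.≤ r) at-i r≡ (≤ᵇ-true {suc (nats s′ neighbour 0 0)} le)))
            (ℕ.s≤s⁻¹ u<1+i)))
          (λ gt _ → J (ℕ.s≤s⁻¹ (≡.subst₂ (λ i r → suc r ℕ.≤ suc i) at-i r≡ (≤ᵇ-false {suc (nats s′ neighbour 0 0)} gt)))))
      (Fin.toℕ<n u)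

    -- While an element is treated, its own cell is still needed in its old state, so
    -- the invariant also describes the cells not treated yet.
    narrow-spec : ∀ s S v u → Ready s → Holds s S → Adj v u →
      nats s chosen 0 0 ≡ toℕ v → nats s response 0 0 ≡ suc (toℕ u) →
      Holds (exec O narrow s) (S ∩ N v u)
    narrow-spec s S v u ready h e at-v at-r x = proj₁
      (for-rule O element narrowStep s₁ (size≡ (loaded ready₁))
        (λ k s′ → ∀ x → (toℕ x ℕ.< k → (1 ≤ᵇ nats s′ candidate (toℕ x) 0) ≡ lookup (S ∩ N v u) x)
                      × (k ℕ.≤ toℕ x → (1 ≤ᵇ nats s′ candidate (toℕ x) 0) ≡ lookup S x))
        (λ x → (λ ()) , λ _ → holds-frame {S = S} f refl h x) (λ _ _ J → J) step x)
      (Fin.toℕ<n x)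
      where
      s₁ = exec O decode s
      f = frame O decode s
      ready₁ : Ready s₁
      ready₁ = ready-frame f refl refl refl refl ready

      -- Elements before i are treated, and those from i on are still as in S.
      step : ∀ i s′ → Frame (for element narrowStep) s₁ s′ → nats s′ element 0 0 ≡ toℕ i →
        (∀ x → (toℕ x ℕ.< toℕ i → (1 ≤ᵇ nats s′ candidate (toℕ x) 0) ≡ lookup (S ∩ N v u) x)
             × (toℕ i ℕ.≤ toℕ x → (1 ≤ᵇ nats s′ candidate (toℕ x) 0) ≡ lookup S x)) →
        ∀ x → (toℕ x ℕ.< suc (toℕ i) → (1 ≤ᵇ nats (exec O narrowStep s′) candidate (toℕ x) 0) ≡ lookup (S ∩ N v u) x)
            × (suc (toℕ i) ℕ.≤ toℕ x → (1 ≤ᵇ nats (exec O narrowStep s′) candidate (toℕ x) 0) ≡ lookup S x)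
      step i s′ f′ at-i J x = cond-rule O (onWay chosen towards) skip (setCandidate (scalar element) 0) s′
        (λ s″ → (toℕ x ℕ.< suc (toℕ i) → (1 ≤ᵇ nats s″ candidate (toℕ x) 0) ≡ lookup (S ∩ N v u) x)
              × (suc (toℕ i) ℕ.≤ toℕ x → (1 ≤ᵇ nats s″ candidate (toℕ x) 0) ≡ lookup S x))
        (λ on → kept (≡.trans (≡.sym isNear) on) , λ i<x → proj₂ (J x) (ℕ.<⇒≤ i<x))
        (λ off → removed at-i (≡.trans (≡.sym isNear) off) , λ i<x → unaffected at-i i<x)
        where
        isNear : test O (onWay chosen towards) s′ ≡ lookup (N v u) i
        isNear = onWay-test s′ chosen towards (ready-frame f′ refl refl refl refl ready₁) e
          (≡.trans (nats≡ f′ chosen refl 0 0) (≡.trans (nats≡ f chosen refl 0 0) at-v))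
          (≡.trans (nats≡ f′ towards refl 0 0) (decode-spec s u (size≡ (loaded ready)) at-r)) at-i
        in∩ : ∀ x → lookup (S ∩ N v u) x ≡ lookup S x ∧ lookup (N v u) x
        in∩ x = Vec.lookup-zipWith _∧_ x S (N v u)
        kept : lookup (N v u) i ≡ true → toℕ x ℕ.< suc (toℕ i) →
               (1 ≤ᵇ nats s′ candidate (toℕ x) 0) ≡ lookup (S ∩ N v u) x
        kept i∈N x≤i with x Fin.≟ i
        ... | no  x≢i  = proj₁ (J x) (ℕ.≤∧≢⇒< (ℕ.s≤s⁻¹ x≤i) (x≢i ∘ Fin.toℕ-injective))
        ... | yes refl = ≡.trans (proj₂ (J x) ℕ.≤-refl) (≡.sym (≡.trans (in∩ x)
                           (≡.trans (≡.cong (lookup S x ∧_) i∈N) (Bool.∧-identityʳ _))))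
        removed : ∀ {k} → k ≡ toℕ i → lookup (N v u) i ≡ false → toℕ x ℕ.< suc (toℕ i) →
                  (1 ≤ᵇ store candidate k 0 0 (nats s′) candidate (toℕ x) 0) ≡ lookup (S ∩ N v u) x
        removed refl i∉N x≤i with x Fin.≟ i
        ... | yes refl = ≡.trans (≡.cong (1 ≤ᵇ_) (store-same candidate (toℕ i) 0 0 (nats s′)))
                           (≡.sym (≡.trans (in∩ x) (≡.trans (≡.cong (lookup S x ∧_) i∉N) (Bool.∧-zeroʳ _))))
        ... | no  x≢i with store-cases candidate (toℕ i) 0 0 (nats s′) (toℕ x) 0
        ...   | inj₁ (i≡x , _) = contradiction (Fin.toℕ-injective (≡.sym i≡x)) x≢i
        ...   | inj₂ eq = ≡.trans (≡.cong (1 ≤ᵇ_) eq)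
                            (proj₁ (J x) (ℕ.≤∧≢⇒< (ℕ.s≤s⁻¹ x≤i) (x≢i ∘ Fin.toℕ-injective)))
        unaffected : ∀ {k} → k ≡ toℕ i → toℕ i ℕ.< toℕ x →
                     (1 ≤ᵇ store candidate k 0 0 (nats s′) candidate (toℕ x) 0) ≡ lookup S x
        unaffected refl i<x with store-cases candidate (toℕ i) 0 0 (nats s′) (toℕ x) 0
        ... | inj₁ (i≡x , _) = contradiction i≡x (ℕ.<⇒≢ i<x)
        ... | inj₂ eq = ≡.trans (≡.cong (1 ≤ᵇ_) eq) (proj₂ (J x) (ℕ.<⇒≤ i<x))

-- Correctness of median search

module Correctness {c ℓ₁ ℓ₂} (R : RealField c ℓ₁ ℓ₂) where
  open RealField R hiding (refl; sym; trans)
  open DirectionSearch R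
  open Machine R
  open Search R
  open Paths R
  open Rounds R

  module Run {n} (G : Graph n) {t : Fin n} {O : Responder n} (truthful : Truthful G t O)
             (ε : Carrier) (0≤ε : 0# ≤ ε) (ε<1 : ε < 1#) where
    open Graph G
    open Distance G using (minimiser-isMedian)
    open FloydWarshall G O
    open Median G O
    open Loaded
    open Ready
    open Medians G ε 0≤ε ε<1

    -- What the program's candidates' set S has to do with the history.  The two
    -- agree until the target is found; then S is the target alone.
    record Knows (h : History n) (S : Subset n) : Set ℓ₂ where
      field
        answered : Answered G t h
        medians  : MedianHistory G ε h
        target∈  : t ∈ S
        status   : (¬ Any IsFound h × S ≡ candidates G h) ⊎ (Any IsFound h × ∣ S ∣ ≡ 1)
    open Knows

    -- The invariant of the rounds: after k rounds one candidate is left or at least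
    -- k are gone.
    record Searching (k : ℕ) (s : Config n) : Set (c ⊔ ℓ₁ ⊔ ℓ₂) where
      field
        ready    : Ready s
        {S}      : Subset n
        holds    : Holds s S
        knows    : Knows (history s) S
        progress : ∣ S ∣ ≡ 1 ⊎ ∣ S ∣ ℕ.+ k ℕ.≤ n
    open Searching

    undetected : ∀ {h S} → Knows h S → 2 ℕ.≤ ∣ S ∣ → ¬ Detected G h × S ≡ candidates G h
    undetected kn 2≤ with status kn
    ... | inj₂ (_ , ≡1) = contradiction (ℕ.≤-trans 2≤ (ℕ.≤-reflexive ≡1)) λ { (ℕ.s≤s ()) }
    ... | inj₁ (¬found , refl) = (λ { (inj₁ fnd) → ¬found fnd
                                    ; (inj₂ ≡1) → contradiction (ℕ.≤-trans 2≤ (ℕ.≤-reflexive ≡1)) λ { (ℕ.s≤s ()) } }) , refl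

    detected : ∀ {h S} → Knows h S → ∣ S ∣ ≡ 1 → Detected G h
    detected kn ≡1 with status kn
    ... | inj₁ (_ , refl) = inj₂ ≡1
    ... | inj₂ (fnd , _)  = inj₁ fnd

    -- The round after a query at the median v with response r, from the candidates'
    -- set S before the query.
    respond-spec : ∀ k s h v r {S} → history s ≡ (v , r) ∷ h → nats s response 0 0 ≡ code O r →
      nats s chosen 0 0 ≡ toℕ v → Ready s → Holds s S → Knows h S → 2 ℕ.≤ ∣ S ∣ → ∣ S ∣ ℕ.+ k ℕ.≤ n →
      IsMedian ε S v → Correct G t v r → Searching (suc k) (exec O respond s)
    respond-spec k s h v r {S} hist at-r at-v rdy hld kn 2≤ prog med correct =
      cond-rule O (scalar response ≤ⁿ lit 0) keepChosen narrow s (Searching (suc k))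
        (λ le → isFound correct at-r (≤ᵇ-true le)) (λ gt → isToward correct at-r (≤ᵇ-false gt))
      where
      s₁ = tick O s
      ready₁ : Ready s₁
      ready₁ = ready-frame (frame O skip s) refl refl refl refl rdy
      ¬det : ¬ Detected G h
      ¬det = proj₁ (undetected kn 2≤)
      S≡ : S ≡ candidates G h
      S≡ = proj₂ (undetected kn 2≤)
      med′ : MedianHistory G ε ((v , r) ∷ h)
      med′ = query ¬det (≡.subst (λ S → IsMedian ε S v) S≡ med) (medians kn)
      isFound : Correct G t v r → nats s response 0 0 ≡ code O r → nats s response 0 0 ℕ.≤ 0 →
                Searching (suc k) (exec O keepChosen s₁)
      isFound (found refl) _ _ = record
        { ready    = ready-frame (frame O keepChosen s₁) refl refl refl refl ready₁
        ; holds    = keepChosen-spec s₁ v (size≡ (loaded rdy)) at-v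
        ; knows    = ≡.subst (λ h → Knows h ⁅ v ⁆)
            (≡.sym (≡.trans (history≡ (frame O keepChosen s₁) refl) hist)) (record
              { answered = found refl ∷ answered kn
              ; medians  = med′
              ; target∈  = Subset.x∈⁅x⁆ v
              ; status   = inj₂ (here found , Subset.∣⁅x⁆∣≡1 v) })
        ; progress = inj₁ (Subset.∣⁅x⁆∣≡1 v)
        }
      isFound (toward _ _ _) eq le = contradiction (≡.subst (ℕ._≤ 0) eq le) λ ()
      isToward : Correct G t v r → nats s response 0 0 ≡ code O r → 0 ℕ.< nats s response 0 0 →
                 Searching (suc k) (exec O narrow s₁)
      isToward (found _) eq gt = contradiction (≡.subst (0 ℕ.<_) eq gt) λ ()
      isToward (toward {u} v≢t e t∈N) eq _ = record
        { ready    = ready-frame (frame O narrow s₁) refl refl refl refl ready₁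
        ; holds    = narrow-spec s₁ S v u ready₁ hld e at-v eq
        ; knows    = ≡.subst (λ h → Knows h (S ∩ N v u))
            (≡.sym (≡.trans (history≡ (frame O narrow s₁) refl) hist)) (record
              { answered = toward v≢t e t∈N ∷ answered kn
              ; medians  = med′
              ; target∈  = Subset.x∈p∩q⁺ (target∈ kn , t∈N)
              ; status   = inj₁ ((λ { (there fnd) → ¬det (inj₁ fnd) }) , ≡.cong (_∩ N v u) S≡) })
        ; progress = inj₂ (ℕ.≤-trans (ℕ.≤-reflexive (ℕ.+-suc _ k))
            (ℕ.≤-trans (ℕ.+-monoˡ-≤ k (shrink-< (target∈ kn) med e)) prog))
        }

    query-spec : ∀ k s {S} v → nats s chosen 0 0 ≡ toℕ v → IsMedian ε S v →
      Ready s → Holds s S → Knows (history s) S → 2 ℕ.≤ ∣ S ∣ → ∣ S ∣ ℕ.+ k ℕ.≤ n →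
      Searching (suc k) (exec O (query (scalar chosen) response ⨾ respond) s)
    query-spec k s {S} v at-v med rdy hld kn 2≤ prog =
      respond-spec k s₁ (history s) v (O (history s) v)
        (≡.cong history asked) (≡.cong (λ s′ → nats s′ response 0 0) asked)
        (≡.trans (nats≡ f chosen refl 0 0) at-v) (ready-frame f refl refl refl refl rdy)
        (holds-frame {S = S} f refl hld) kn 2≤ prog med (truthful (history s) v)
      where
      s₁ = exec O (query (scalar chosen) response) s
      f = frame O (query (scalar chosen) response) s
      asked : s₁ ≡ ask O response v (tick O s)
      asked = query-at O (scalar chosen) response s v at-v

    searchStep-spec : ∀ k s {S} → Ready s → Holds s S → Knows (history s) S → 2 ℕ.≤ ∣ S ∣ →
      ∣ S ∣ ℕ.+ k ℕ.≤ n → Searching (suc k) (exec O searchStep s)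
    searchStep-spec k s {S} rdy hld kn 2≤ prog =
      let v , at-v , minimal = findMedian-spec s S t rdy hld in
      query-spec k (exec O findMedian s) v at-v (minimiser-isMedian 0≤ε minimal)
        (ready-frame f refl refl refl refl rdy) (holds-frame {S = S} f refl hld)
        (≡.subst (λ h → Knows h S) (≡.sym (history≡ f refl)) kn) 2≤ prog
      where
      f = frame O findMedian s

    searching-stable : ∀ k {p} {s s′} → Frame p s s′ →
      writesⁿ p 0 ≡ false → writesⁿ p adjacency ≡ false → writesⁿ p candidate ≡ false →
      writesʷ p edge ≡ false → writesʷ p dist ≡ false → queries p ≡ false →
      Searching k s → Searching k s′
    searching-stable k f w₀ w₁ w₂ w₃ w₄ q sr = record
      { ready    = ready-frame f w₀ w₁ w₃ w₄ (ready sr)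
      ; holds    = holds-frame {S = S sr} f w₂ (holds sr)
      ; knows    = ≡.subst (λ h → Knows h (S sr)) (≡.sym (history≡ f q)) (knows sr)
      ; progress = progress sr
      }

    searchRound-spec : ∀ k s → Searching k s → Searching (suc k) (exec O searchRound s)
    searchRound-spec k s sr = cond-rule O (lit 2 ≤ⁿ scalar count) searchStep skip s₁ (Searching (suc k))
      (λ le → several (≡.subst (2 ℕ.≤_) counted (≤ᵇ-true le)) (progress sr))
      (λ gt → single (≡.subst (ℕ._< 2) counted (≤ᵇ-false gt)))
      where
      s₁ = exec O (countWith tally) s
      counted : nats s₁ count 0 0 ≡ ∣ S sr ∣
      counted = tally-spec s (S sr) (size≡ (loaded (ready sr))) (holds sr)
      sr₂ : Searching k (tick O s₁)
      sr₂ = searching-stable k (frame-⨾ O (frame O (countWith tally) s) (frame O skip s₁))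
              refl refl refl refl refl refl sr
      several : 2 ℕ.≤ ∣ S sr ∣ → ∣ S sr ∣ ≡ 1 ⊎ ∣ S sr ∣ ℕ.+ k ℕ.≤ n → Searching (suc k) (exec O searchStep (tick O s₁))
      several 2≤ (inj₁ ≡1) = contradiction (ℕ.≤-trans 2≤ (ℕ.≤-reflexive ≡1)) λ { (ℕ.s≤s ()) }
      several 2≤ (inj₂ prog) = searchStep-spec k (tick O s₁) (ready sr₂) (holds sr₂) (knows sr₂) 2≤ prog
      single : ∣ S sr ∣ ℕ.< 2 → Searching (suc k) (tick O (tick O s₁))
      single <2 = searching-stable (suc k) (frame O skip (tick O s₁)) refl refl refl refl refl refl (record
        { ready = ready sr₂ ; holds = holds sr₂ ; knows = knows sr₂
        ; progress = inj₁ (ℕ.≤-antisym (ℕ.s≤s⁻¹ <2) (0<∣S∣ (target∈ (knows sr)))) })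

    report-spec : ∀ s {S} → nats s 0 0 0 ≡ n → Holds s S → t ∈ S → ∣ S ∣ ≡ 1 →
      output (exec O report s) ≡ toℕ t
    report-spec s {S} size h t∈S ∣S∣≡1 = proj₂ (for-each O element reportStep s size (λ _ → Unit)
      (λ x s′ → x ≡ t → output s′ ≡ toℕ t) tt (λ _ _ J → J) (λ _ _ _ J → J) step) t refl
      where
      reportStep = cond isCandidate (result := scalar element) skip
      step : ∀ x s′ → Frame report s s′ → nats s′ element 0 0 ≡ toℕ x → Unit →
        Unit × (x ≡ t → output (exec O reportStep s′) ≡ toℕ t) ×
        (∀ j → j ≢ x → (j ≡ t → output s′ ≡ toℕ t) → j ≡ t → output (exec O reportStep s′) ≡ toℕ t)
      step x s′ f at-x _ = tt , cond-rule O isCandidate (result := scalar element) skip s′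
          (λ s″ → (x ≡ t → output s″ ≡ toℕ t) × (∀ j → j ≢ x → (j ≡ t → output s′ ≡ toℕ t) → j ≡ t → output s″ ≡ toℕ t))
          (λ is → (λ x≡t → ≡.trans at-x (≡.cong toℕ x≡t))
                , λ _ _ _ _ → ≡.trans at-x (≡.cong toℕ (∣S∣≡1⇒unique ∣S∣≡1 t∈S
                    (Vec.lookup⇒[]= x S (≡.trans (≡.sym inS) is)))))
          (λ not → (λ { refl → contradiction (≡.trans (≡.sym (Vec.[]=⇒lookup t∈S)) (≡.trans (≡.sym inS) not)) λ () })
                , λ _ _ old → old)
        where
        inS : test O isCandidate s′ ≡ lookup S x
        inS = isCandidate-test s′ S x (holds-frame {S = S} f refl h) at-x

    finished : ∀ {s} (sr : Searching n s) → ∣ S sr ∣ ≡ 1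
    finished sr with progress sr
    ... | inj₁ ≡1 = ≡1
    ... | inj₂ le = contradiction (ℕ.+-monoˡ-≤ n (0<∣S∣ (target∈ (knows sr)))) (ℕ.≤⇒≯ le)

    -- What is required of the final configuration, apart from the number of queries
    -- and the running time.
    record Success (s : Config n) : Set ℓ₂ where
      field
        answered′ : Answered G t (history s)
        medians′  : MedianHistory G ε (history s)
        detected′ : Detected G (history s)
        output≡   : output s ≡ toℕ t

    -- The distance table must be empty at the start.  The n rounds of the last loop
    -- suffice because each one removes a candidate of the n at the start, or ends
    -- with a single one.
    main-spec : ∀ s → Loaded s → (∀ u v → nats s reached (toℕ u) (toℕ v) ≡ 0) → history s ≡ [] →
                Success (exec O main s)
    main-spec s ld unreached hist = record
      { answered′ = ≡.subst (Answered G t) (≡.sym h₅) (answered (knows final))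
      ; medians′  = ≡.subst (MedianHistory G ε) (≡.sym h₅) (medians (knows final))
      ; detected′ = ≡.subst (Detected G) (≡.sym h₅) (detected (knows final) one)
      ; output≡   = report-spec s₄ (size≡ (loaded (ready final))) (holds final) (target∈ (knows final)) one
      }
      where
      s₁ = exec O (fill 1) s
      s₂ = exec O relaxEdges s₁
      s₃ = exec O floydWarshall s₂
      s₄ = exec O (for round searchRound) s₃
      f₁ = frame O (fill 1) s
      f₂ = frame O relaxEdges s₁
      f₃ = frame O floydWarshall s₂
      loaded₁ : Loaded s₁
      loaded₁ = loaded-frame f₁ refl refl refl ld
      loaded₂ : Loaded s₂
      loaded₂ = loaded-frame f₂ refl refl refl loaded₁
      sound₁ : Sound (Table s₁)
      sound₁ {u} {v} (r , _) = contradiction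
        (≡.subst (1 ℕ.≤_) (≡.trans (nats≡ f₁ reached refl (toℕ u) (toℕ v)) (unreached u v)) r) λ ()
      edges₂ = relaxEdges-spec s₁ loaded₁ sound₁
      ready₃ : Ready s₃
      ready₃ = loaded-frame f₃ refl refl refl loaded₂
             , floydWarshall-spec s₂ (size≡ loaded₂) (proj₁ edges₂) (proj₂ edges₂)
      hist₃ : history s₃ ≡ []
      hist₃ = ≡.trans (history≡ f₃ refl) (≡.trans (history≡ f₂ refl) (≡.trans (history≡ f₁ refl) hist))
      ∣⊤∣+0≤n : ∣ ⊤ {n} ∣ ℕ.+ 0 ℕ.≤ n
      ∣⊤∣+0≤n = ℕ.≤-reflexive (≡.trans (ℕ.+-identityʳ _) (Subset.∣⊤∣≡n n))
      begin₃ : Searching 0 s₃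
      begin₃ = record
        { ready    = ready₃
        ; holds    = holds-frame {S = ⊤} f₃ refl (holds-frame {S = ⊤} f₂ refl (fill-1-holds s (size≡ ld)))
        ; knows    = ≡.subst (λ h → Knows h ⊤) (≡.sym hist₃) (record
            { answered = [] ; medians = [] ; target∈ = Subset.∈⊤ ; status = inj₁ ((λ ()) , refl) })
        ; progress = inj₂ ∣⊤∣+0≤n
        }
      final : Searching n s₄
      final = for-rule O round searchRound s₃ (size≡ (loaded ready₃)) Searching
        (searching-stable 0 (frame O skip s₃) refl refl refl refl refl refl begin₃)
        (λ k s′ → searching-stable k (frame-enter O round k {e = lit 0} {skip} {s′}) refl refl refl refl refl refl)
        (λ i s′ _ _ → searchRound-spec (toℕ i) s′)
      one : ∣ S final ∣ ≡ 1
      one = finished final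
      h₅ : history (exec O main s) ≡ history s₄
      h₅ = history≡ (frame O report s₄) refl

    atVertices-toℕ : ∀ {a} {A : Set a} (f : Fin n → Fin n → A) z u v →
      atVertices G f z (toℕ u) (toℕ v) ≡ f u v
    atVertices-toℕ f z u v with toℕ u ℕ.<? n | toℕ v ℕ.<? n
    ... | yes u<n | yes v<n = ≡.cong₂ f (Fin.fromℕ<-toℕ u u<n) (Fin.fromℕ<-toℕ v v<n)
    ... | yes _   | no  v≮n = contradiction (Fin.toℕ<n v) v≮n
    ... | no  u≮n | _       = contradiction (Fin.toℕ<n u) u≮n

    input-loaded : Loaded (input G)
    input-loaded = record
      { size≡ = refl
      ; adj≡  = λ u v → ≡.trans (≡.cong (1 ≤ᵇ_) (atVertices-toℕ _ 0 u v)) (one≤ ⌊ adj? u v ⌋)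
      ; edge≈ = λ {u} {v} e → reflexive (≡.trans (atVertices-toℕ _ 0# u v) (chosen≡ (adj? u v) e))
      }
      where
      one≤ : ∀ b → (1 ≤ᵇ (if b then 1 else 0)) ≡ b
      one≤ true  = refl
      one≤ false = refl
      chosen≡ : ∀ {P : Set} {x : Carrier} (P? : Dec P) → P → (if ⌊ P? ⌋ then x else 0#) ≡ x
      chosen≡ (yes _) _ = refl
      chosen≡ (no ¬p) p = contradiction p ¬p

    run-success : Success (run G main O)
    run-success = main-spec (input G) input-loaded (λ _ _ → refl) refl

    -- The polynomial bound is read off the program; only its loops need checking.
    run-time : time (run G main O) ℕ.≤ size main ℕ.* n ^ depth main
    run-time = ℕ.≤-trans (time-≤ O main (input G) bounded refl refl) (steps-≤ n {{Fin.nonZeroIndex t}} main)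
      where
      bounded : Bounded main
      bounded = (refl , _)
              , (refl , (refl , _) , _)
              , (refl , refl , refl , _)
              , (refl , (_ , refl , _) ,
                  ((_ , refl , (_ , refl , (( _ , refl , _) , _) , _) , _) , _ , ((refl , _) , _) , (refl , _) , refl , _) , _)
              , (refl , _)

theorem4 :
  ∀ {c ℓ₁ ℓ₂} (R : RealField c ℓ₁ ℓ₂) →
  let open RealField R
      open DirectionSearch R in
  (ε : Carrier) → 0# ≤ ε → ε < 1# →
  -- any choice of medians detects the target within the bound
  (∀ {n} (G : Graph n) (t : Fin n) (O : Responder n) → Truthful G t O →
   (σ : Strategy n) → QueriesMedians G ε O σ →
   ∃ λ k → Detected G (play σ O k) × fromℕ k ≤ queryBound n ε)
  ×
  -- and such choices can be made in polynomial time
  (∃ λ (p : Program) → ∃₂ λ (a b : ℕ) →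
   ∀ {n} (G : Graph n) (t : Fin n) (O : Responder n) → Truthful G t O →
   let s = run G p O in
   time s ℕ.≤ a ℕ.* n ^ b
   × MedianHistory G ε (history s)
   × Detected G (history s)
   × fromℕ (length (history s)) ≤ queryBound n ε
   × output s ≡ toℕ t)
theorem4 R ε 0≤ε ε<1 =
    (λ G t O truthful σ medians → Search.Medians.detects R G ε 0≤ε ε<1 truthful medians)
  , main , size main , depth main
  , λ G t O truthful →
      let open Correctness.Run R G truthful ε 0≤ε ε<1
          open Success run-success in
      run-time , medians′ , detected′ , Search.Medians.medians-within-bound R G ε 0≤ε ε<1 answered′ medians′ , output≡
  where
  open Machine R using (size; depth)
  open Rounds R using (main)
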